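{- Let $n\ge 2$ be an integer. If $G$ is a graph on $2n+1$ vertices with at least $n^2+n$ edges that does not contain two distinct vertices of the same degree joined by a path of length three, then $G$ is isomorphic to the complete bipartite graph $K_{n,n+1}$. (Equivalently, $K_{n,n+1}$ is the unique such graph.)
   Context: Graphs are finite and simple. A path of length three joining vertices $a$ and $b$ is a path $a\,x\,y\,b$ with four distinct vertices and three edges $ax, xy, yb$. "Two vertices of the same degree joined by a path of length three" means there are distinct vertices $a,b$ with $d(a)=d(b)$ and a path of length three with endpoints $a$ and $b$. -}

module Defs where

open import Data.Nat using (ℕ; zero; suc; _+_; _*_; _<_; _≤_; _<ᵇ_)
open import Data.Bool using (Bool; true; false; if_then_else_; not; _xor_)
open import Data.Fin using (Fin; toℕ)
open import Data.List using (List; length; filter; allFin; concatMap; map)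
open import Data.List.Membership.Propositional using (_∈_)
open import Data.Product using (_×_; _,_; Σ; ∃)
open import Relation.Binary.PropositionalEquality using (_≡_; _≢_)
open import Relation.Nullary using (¬_)
open import Function.Bundles using (_⤖_; Func)
open import Data.Bool using (T)

record Graph (V : ℕ) : Set where
  field
    adj     : Fin V → Fin V → Bool
    sym     : ∀ u v → adj u v ≡ adj v u
    irrefl  : ∀ v → adj v v ≡ false
open Graph public

_~[_]_ : ∀ {V} → Fin V → Graph V → Fin V → Set
u ~[ G ] v = T (adj G u v)

degree : ∀ {V} → Graph V → Fin V → ℕ
degree {V} G v = length (filter (λ u → Data.Bool.Properties.T? (adj G v u)) (allFin V))
  where import Data.Bool.Properties

edgeCount : ∀ {V} → Graph V → ℕ
edgeCount {V} G =
  length (filter (λ p → Data.Bool.Properties.T? (adjOrd p))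
                 (concatMap (λ u → map (λ v → u , v) (allFin V)) (allFin V)))
  where
    import Data.Bool.Properties
    adjOrd : Fin V × Fin V → Bool
    adjOrd (u , v) with toℕ u <ᵇ toℕ v
    ... | true  = adj G u v
    ... | false = false

record P3 {V} (G : Graph V) (a b : Fin V) : Set where
  field
    x y   : Fin V
    a≢x : a ≢ x
    a≢y : a ≢ y
    a≢b : a ≢ b
    x≢y : x ≢ y
    x≢b : x ≢ b
    y≢b : y ≢ b
    ax  : a ~[ G ] x
    xy  : x ~[ G ] y
    yb  : y ~[ G ] b

HasEqualDegreeP3 : ∀ {V} → Graph V → Set
HasEqualDegreeP3 {V} G =
  Σ (Fin V) λ a → Σ (Fin V) λ b → a ≢ b × degree G a ≡ degree G b × P3 G a b

_≅_ : ∀ {V W} → Graph V → Graph W → Set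
_≅_ {V} {W} G H =
  Σ (Fin V ⤖ Fin W) λ f →
    ∀ u v → adj G u v ≡ adj H (Bijection.to f u) (Bijection.to f v)
  where open Function.Bundles

K : (m k : ℕ) → Graph (m + k)
K m k = record { adj = λ u v → side u xor side v ; sym = λ u v → xor-comm (side u) (side v)
               ; irrefl = λ v → xor-same (side v) }
  where
    side : Fin (m + k) → Bool
    side u = toℕ u <ᵇ m
    xor-comm : ∀ a b → (a xor b) ≡ (b xor a)
    xor-comm false false = Relation.Binary.PropositionalEquality.refl
    xor-comm false true = Relation.Binary.PropositionalEquality.refl
    xor-comm true false = Relation.Binary.PropositionalEquality.refl
    xor-comm true true = Relation.Binary.PropositionalEquality.refl
    xor-same : ∀ a → (a xor a) ≡ false
    xor-same false = Relation.Binary.PropositionalEquality.refl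
    xor-same true = Relation.Binary.PropositionalEquality.refl

{-# OPTIONS --safe #-}
module Submission where

-- Write V = 2n + 1, call d v + d w − V the surplus of an edge vw (a deficit if
-- negative) and (d v − n)(d v − n − 1) ≥ 0 the cost of a vertex v.  Since
-- ∑ cost = ∑ d v² − V ∑ d v + V n (n + 1), having at least n² + n edges gives
--   2 ∑ cost + total deficit ≤ total surplus,
-- totals being over ordered adjacent pairs.  If no edge has a surplus, all terms
-- vanish: degrees are n or n + 1, every edge joins the two classes, and G is
-- K n (n + 1).
-- If some edge has a surplus, the inequality fails.  Charge each edge to its end
-- of larger degree.  If a ≢ b have equal degree and x ≢ b is a neighbour of a,
-- then d a + d x ≤ V − 2 + [a ∼ b] + 2 [b ∼ x]; hence a vertex sharing its degree
-- with another one is charged less than it pays.  A vertex v of unique degree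
-- n + 1 + i may be charged up to 2 (i² + 1) too much, because its neighbours
-- along surplus edges have almost distinct degrees.  All these excesses together
-- are compensated by the cost of the low-degree neighbours of the vertex u of
-- largest such degree: u has many neighbours, and for the same reason few of them
-- have degree near n.

open import Defs
import Algebra.Properties.Semiring.Sum
open import Data.Bool using (Bool; true; false; T; if_then_else_; _xor_)
open import Data.Bool.Properties using (T?; T-≡; ¬-not)
open import Data.Empty using (⊥; ⊥-elim)
open import Data.Fin using (Fin; zero; suc; toℕ; fromℕ; fromℕ<; inject₁)
open import Data.Fin.Properties using (_≟_; any?; toℕ-fromℕ<; toℕ-fromℕ; toℕ-inject₁; suc-injective; fromℕ≢inject₁; inject₁-injective)
open import Data.Fin.Relation.Unary.Top using (view; ‵fromℕ; ‵inject₁)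
open import Data.List using (length; filter; concatMap; map; tabulate; allFin; _++_)
open import Data.List.Membership.Propositional.Properties using (∈-filter⁺; ∈-allFin)
open import Data.List.Properties using (filter-++; length-++; map-tabulate)
import Data.List.Relation.Unary.All as All
open import Data.List.Relation.Unary.All.Properties using (all-filter)
open import Data.Nat as ℕ hiding (_≟_; _≤?_)
open import Data.Nat.Properties hiding (_≟_; suc-injective)
open import Data.Nat.Tactic.RingSolver using (solve-∀)
open import Data.Product using (_×_; _,_; ∃; Σ-syntax; proj₁; proj₂)
open import Data.Sum using (_⊎_; inj₁; inj₂)
open import Function using (_∘_)
open import Function.Bundles using (mk⤖; Equivalence)
open import Function.Consequences.Propositional using (strictlySurjective⇒surjective)
open import Relation.Binary using (Tri; tri<; tri≈; tri>)
open import Relation.Binary.PropositionalEquality as ≡ using (_≡_; _≢_; refl; cong; cong₂; subst)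
open import Relation.Nullary using (¬_; Dec; yes; no; does; _×-dec_; ¬?)
open import Relation.Nullary.Decidable using (dec-true; dec-false)
open import Relation.Unary using (Pred; Decidable)
import Data.List.Extrema ≤-totalOrder as Extrema
open Algebra.Properties.Semiring.Sum +-*-semiring
  using (sum; sum-cong-≗; ∑-distrib-+; ∑-comm; *-distribˡ-sum; *-distribʳ-sum)

-- Sums and counts over finite sets

-- Lets the ring solver prove linear inequalities: X ≤ Y follows from A ≤ B
-- once X + B (plus some slack) and Y + A agree as polynomials.
≤-from : ∀ {A B} s X Y → A ≤ B → X + B + s ≡ Y + A → X ≤ Y
≤-from {A} {B} s X Y A≤B eq = +-cancelʳ-≤ A X Y (begin
  X + A      ≤⟨ +-monoʳ-≤ X A≤B ⟩
  X + B      ≤⟨ m≤m+n (X + B) s ⟩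
  X + B + s  ≡⟨ eq ⟩
  Y + A      ∎)
  where open ≤-Reasoning

sum-mono : ∀ {m} {f g : Fin m → ℕ} → (∀ i → f i ≤ g i) → sum f ≤ sum g
sum-mono {zero}  f≤g = z≤n
sum-mono {suc m} f≤g = +-mono-≤ (f≤g zero) (sum-mono (f≤g ∘ suc))

sum-mono-< : ∀ {m} {f g : Fin m → ℕ} → (∀ i → f i ≤ g i) →
  ∀ i → f i < g i → sum f < sum g
sum-mono-< f≤g zero    f<g = +-mono-<-≤ f<g (sum-mono (f≤g ∘ suc))
sum-mono-< f≤g (suc i) f<g = +-mono-≤-< (f≤g zero) (sum-mono-< (f≤g ∘ suc) i f<g)

term≤sum : ∀ {m} (f : Fin m → ℕ) i → f i ≤ sum f
term≤sum f zero    = m≤m+n _ _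
term≤sum f (suc i) = ≤-trans (term≤sum (f ∘ suc) i) (m≤n+m _ _)

sum≡0⇒≡0 : ∀ {m} (f : Fin m → ℕ) → sum f ≡ 0 → ∀ i → f i ≡ 0
sum≡0⇒≡0 f eq i = n≤0⇒n≡0 (subst (f i ≤_) eq (term≤sum f i))

sum-const : ∀ m c → sum {m} (λ _ → c) ≡ m * c
sum-const zero    c = refl
sum-const (suc m) c = cong (c +_) (sum-const m c)

sum-zero : ∀ {m} {f : Fin m → ℕ} → (∀ i → f i ≡ 0) → sum f ≡ 0
sum-zero {m} f≡0 = ≡.trans (sum-cong-≗ f≡0) (≡.trans (sum-const m 0) (*-zeroʳ m))

sum-split : ∀ a b (f : ℕ → ℕ) →
  sum {a + b} (f ∘ toℕ) ≡ sum {a} (f ∘ toℕ) + sum {b} (f ∘ (a +_) ∘ toℕ)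
sum-split zero    b f = refl
sum-split (suc a) b f =
  ≡.trans (cong (f 0 +_) (sum-split a b (f ∘ suc))) (≡.sym (+-assoc (f 0) _ _))

-- Iverson bracket
[_] : ∀ {p} {P : Set p} → Dec P → ℕ
[ d ] = if does d then 1 else 0

[]≤1 : ∀ {p} {P : Set p} (d : Dec P) → [ d ] ≤ 1
[]≤1 (yes _) = ≤-refl
[]≤1 (no _)  = z≤n

[]-yes : ∀ {p} {P : Set p} (d : Dec P) → P → [ d ] ≡ 1
[]-yes (yes _) p = refl
[]-yes (no ¬p) p = ⊥-elim (¬p p)

[]-no : ∀ {p} {P : Set p} (d : Dec P) → ¬ P → [ d ] ≡ 0
[]-no (yes p) ¬p = ⊥-elim (¬p p)
[]-no (no _)  ¬p = refl

count : ∀ {m p} {P : Pred (Fin m) p} → Decidable P → ℕ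
count P? = sum (λ i → [ P? i ])

count-none : ∀ {m p} {P : Pred (Fin m) p} (P? : Decidable P) → (∀ i → ¬ P i) → count P? ≡ 0
count-none P? none = sum-zero λ i → []-no (P? i) (none i)

count≤1 : ∀ {m p} {P : Pred (Fin m) p} (P? : Decidable P) →
  (∀ i j → P i → P j → i ≡ j) → count P? ≤ 1
count≤1 {zero}  P? uniq = z≤n
count≤1 {suc m} P? uniq with P? zero
... | yes p0 = s≤s (≤-reflexive (count-none (P? ∘ suc) none))
  where
    none : ∀ i → ¬ _
    none i pi with () ← uniq zero (suc i) p0 pi
... | no _   = count≤1 (P? ∘ suc) λ i j pi pj → suc-injective (uniq _ _ pi pj)

count≤2 : ∀ {m p} {P : Pred (Fin m) p} (P? : Decidable P) →
  (∀ i j k → P i → P j → P k → i ≢ j → i ≢ k → j ≢ k → ⊥) → count P? ≤ 2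
count≤2 {zero}  P? no3 = z≤n
count≤2 {suc m} P? no3 with P? zero
... | yes p0 = s≤s (count≤1 (P? ∘ suc) uniq)
  where
    uniq : ∀ i j → _ → _ → i ≡ j
    uniq i j pi pj with i ≟ j
    ... | yes eq = eq
    ... | no i≢j = ⊥-elim (no3 zero (suc i) (suc j) p0 pi pj (λ ()) (λ ()) (i≢j ∘ suc-injective))
... | no _   = count≤2 (P? ∘ suc) λ i j k pi pj pk i≢j i≢k j≢k →
  no3 _ _ _ pi pj pk (i≢j ∘ suc-injective) (i≢k ∘ suc-injective) (j≢k ∘ suc-injective)

count-≡ : ∀ {m} (i : Fin m) → count (_≟ i) ≡ 1
count-≡ i = ≤-antisym
  (count≤1 (_≟ i) λ _ _ p q → ≡.trans p (≡.sym q))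
  (subst (_≤ count (_≟ i)) ([]-yes (i ≟ i) refl) (term≤sum _ i))

-- Double counting: an index satisfying `P` contributes its weight at the single level `ℓ i`, so
-- after exchanging the sums each level can be bounded by its cap.
sum-level-bound : ∀ {m p} {P : Pred (Fin m) p} (P? : Decidable P) (ℓ : Fin m → ℕ)
  (cap g : ℕ → ℕ) B → (∀ i → P i → ℓ i < B) →
  (∀ s → count (λ i → P? i ×-dec (ℓ i ℕ.≟ s)) ≤ cap s) →
  sum (λ i → [ P? i ] * g (ℓ i)) ≤ sum {B} (λ s → cap (toℕ s) * g (toℕ s))
sum-level-bound {m} {P = P} P? ℓ cap g B ℓ<B capped = begin
  sum (λ i → [ P? i ] * g (ℓ i))                ≤⟨ sum-mono pointwise ⟩
  sum (λ i → sum {B} (λ s → at i (toℕ s) * g (toℕ s)))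
    ≡⟨ ∑-comm (λ i (s : Fin B) → at i (toℕ s) * g (toℕ s)) ⟩
  sum {B} (λ s → sum (λ i → at i (toℕ s) * g (toℕ s)))
    ≡⟨ sum-cong-≗ (λ (s : Fin B) → *-distribʳ-sum (g (toℕ s)) (λ i → at i (toℕ s))) ⟨
  sum {B} (λ s → count (λ i → P? i ×-dec (ℓ i ℕ.≟ toℕ s)) * g (toℕ s))
    ≤⟨ sum-mono (λ (s : Fin B) → *-monoˡ-≤ (g (toℕ s)) (capped (toℕ s))) ⟩
  sum {B} (λ s → cap (toℕ s) * g (toℕ s))       ∎
  where
    open ≤-Reasoning
    at : Fin m → ℕ → ℕ
    at i s = [ P? i ×-dec (ℓ i ℕ.≟ s) ]
    pointwise : ∀ i → [ P? i ] * g (ℓ i) ≤ sum {B} (λ s → at i (toℕ s) * g (toℕ s))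
    pointwise i with P? i in eq
    ... | no _  = z≤n
    ... | yes p = begin
      1 * g (ℓ i)                            ≡⟨ cong₂ (λ x y → x * g y) (≡.sym ([]-yes (yes p ×-dec (ℓ i ℕ.≟ toℕ s₀)) (p , ≡.sym s₀≡))) (≡.sym s₀≡) ⟩
      [ yes p ×-dec (ℓ i ℕ.≟ toℕ s₀) ] * g (toℕ s₀)
                                             ≤⟨ term≤sum (λ s → [ yes p ×-dec (ℓ i ℕ.≟ toℕ s) ] * g (toℕ s)) s₀ ⟩
      _                                      ∎
      where
        s₀ : Fin B
        s₀ = fromℕ< (ℓ<B i p)
        s₀≡ : toℕ s₀ ≡ ℓ i
        s₀≡ = toℕ-fromℕ< (ℓ<B i p)

length-filter-tabulate : ∀ {a p} {A : Set a} {P : Pred A p} (P? : Decidable P) {m} (f : Fin m → A) →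
  length (filter P? (tabulate f)) ≡ sum (λ i → [ P? (f i) ])
length-filter-tabulate P? {zero}  f = refl
length-filter-tabulate P? {suc m} f with does (P? (f zero))
... | true  = cong suc (length-filter-tabulate P? (f ∘ suc))
... | false = length-filter-tabulate P? (f ∘ suc)

length-filter-pairs : ∀ {a b p} {A : Set a} {B : Set b} {P : Pred (A × B) p} (P? : Decidable P)
  {m k} (f : Fin m → A) (g : Fin k → B) →
  length (filter P? (concatMap (λ x → map (x ,_) (tabulate g)) (tabulate f)))
    ≡ sum (λ i → sum (λ j → [ P? (f i , g j) ]))
length-filter-pairs P? {zero}  f g = refl
length-filter-pairs P? {suc m} f g = begin
  length (filter P? (map (f zero ,_) (tabulate g) ++ rest))
    ≡⟨ cong length (filter-++ P? (map (f zero ,_) (tabulate g)) rest) ⟩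
  length (filter P? (map (f zero ,_) (tabulate g)) ++ filter P? rest)
    ≡⟨ length-++ (filter P? (map (f zero ,_) (tabulate g))) ⟩
  length (filter P? (map (f zero ,_) (tabulate g))) + length (filter P? rest)
    ≡⟨ cong₂ _+_ (≡.trans (cong (length ∘ filter P?) (map-tabulate g (f zero ,_)))
                          (length-filter-tabulate P? (λ j → f zero , g j)))
                 (length-filter-pairs P? (f ∘ suc) g) ⟩
  _ ∎
  where
    open ≡.≡-Reasoning
    rest = concatMap (λ x → map (x ,_) (tabulate g)) (tabulate (f ∘ suc))

-- Half of the handshake lemma

module _ {V} (G : Graph V) where

  degree-count : ∀ v → degree G v ≡ count (λ w → T? (adj G v w))
  degree-count v = length-filter-tabulate (λ w → T? (adj G v w)) (λ i → i)

  -- Gives a name to the predicate that is local to the definition of edgeCount.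
  edgeCount-pairs : Σ[ Q ∈ (Fin V × Fin V → Bool) ]
    edgeCount G ≡ length (filter (λ p → T? (Q p)) (concatMap (λ u → map (u ,_) (allFin V)) (allFin V)))
  edgeCount-pairs = _ , refl

  orderedAdj : Fin V × Fin V → Bool
  orderedAdj = proj₁ edgeCount-pairs

  -- At most one of the two orders has the smaller index first, and only that one can count.
  orderedAdj≤ : ∀ u v → [ T? (orderedAdj (u , v)) ] + [ T? (orderedAdj (v , u)) ] ≤ [ T? (adj G u v) ]
  orderedAdj≤ u v with toℕ u <ᵇ toℕ v in lt | toℕ v <ᵇ toℕ u in gt
  ... | true  | true  = ⊥-elim (<-asym (<ᵇ⇒< (toℕ u) _ (subst T (≡.sym lt) _)) (<ᵇ⇒< (toℕ v) _ (subst T (≡.sym gt) _)))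
  ... | true  | false = ≤-reflexive (+-identityʳ _)
  ... | false | true  = ≤-reflexive (cong (λ b → [ T? b ]) (Graph.sym G v u))
  ... | false | false = z≤n

  2*edgeCount≤ : edgeCount G + edgeCount G ≤ sum (degree G)
  2*edgeCount≤ = begin
    edgeCount G + edgeCount G  ≡⟨ cong₂ _+_ eq (≡.trans eq (∑-comm (λ u v → E (u , v)))) ⟩
    sum (λ u → sum (λ v → E (u , v))) + sum (λ u → sum (λ v → E (v , u)))
      ≡⟨ ∑-distrib-+ (λ u → sum (λ v → E (u , v))) (λ u → sum (λ v → E (v , u))) ⟨
    sum (λ u → sum (λ v → E (u , v)) + sum (λ v → E (v , u)))
      ≡⟨ sum-cong-≗ (λ u → ∑-distrib-+ (λ v → E (u , v)) (λ v → E (v , u))) ⟨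
    sum (λ u → sum (λ v → E (u , v) + E (v , u)))
      ≤⟨ sum-mono (λ u → sum-mono (λ v → orderedAdj≤ u v)) ⟩
    sum (λ u → sum (λ v → [ T? (adj G u v) ]))
      ≡⟨ sum-cong-≗ degree-count ⟨
    sum (degree G) ∎
    where
      open ≤-Reasoning
      E : Fin V × Fin V → ℕ
      E p = [ T? (orderedAdj p) ]
      eq : edgeCount G ≡ sum (λ u → sum (λ v → E (u , v)))
      eq = length-filter-pairs (λ p → T? (orderedAdj p)) (λ i → i) (λ i → i)

-- Degrees around vertices of equal degree

module Adjacency {V} (G : Graph V) where

  infix 4 _∼_ _∼?_

  _∼_ : Fin V → Fin V → Set
  v ∼ w = v ~[ G ] w

  -- T? computes to the underlying boolean, which would defeat case analysis
  -- on the decision by with-abstraction.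
  opaque
    d : Fin V → ℕ
    d = degree G

    d≡degree : ∀ v → d v ≡ degree G v
    d≡degree v = refl

    _∼?_ : ∀ v w → Dec (v ∼ w)
    v ∼? w = T? (adj G v w)

    degree≡count : ∀ v → d v ≡ count (v ∼?_)
    degree≡count = degree-count G

    [∼]-sym : ∀ v w → [ v ∼? w ] ≡ [ w ∼? v ]
    [∼]-sym v w = cong (λ b → [ T? b ]) (Graph.sym G v w)

  ∼-sym : ∀ {v w} → v ∼ w → w ∼ v
  ∼-sym {v} {w} = subst T (Graph.sym G v w)

  ∼-irrefl : ∀ {v} → ¬ v ∼ v
  ∼-irrefl {v} = subst T (irrefl G v)

  ∼⇒≢ : ∀ {v w} → v ∼ w → v ≢ w
  ∼⇒≢ v∼w refl = ∼-irrefl v∼w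

  degree<V : ∀ v → d v < V
  degree<V v = begin
    suc (d v)                          ≡⟨ cong₂ _+_ (≡.sym (count-≡ v)) (degree≡count v) ⟩
    count (_≟ v) + count (v ∼?_)       ≡⟨ ∑-distrib-+ (λ w → [ w ≟ v ]) (λ w → [ v ∼? w ]) ⟨
    sum (λ w → [ w ≟ v ] + [ v ∼? w ]) ≤⟨ sum-mono pointwise ⟩
    sum {V} (λ _ → 1)                  ≡⟨ ≡.trans (sum-const V 1) (*-identityʳ V) ⟩
    V                                  ∎
    where
      open ≤-Reasoning
      pointwise : ∀ w → [ w ≟ v ] + [ v ∼? w ] ≤ 1
      pointwise w with w ≟ v
      ... | yes refl = s≤s (≤-reflexive ([]-no (v ∼? v) ∼-irrefl))
      ... | no _     = []≤1 (v ∼? w)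

module NoEqualDegreeP3 {V} (G : Graph V) (noP3 : ¬ HasEqualDegreeP3 G) where
  open Adjacency G

  opaque
    unfolding d

    -- Of the six inequations in `P3`, the three along edges follow from irreflexivity.
    no-path : ∀ {a x y b} → a ≢ b → d a ≡ d b → a ∼ x → x ∼ y → y ∼ b → a ≢ y → x ≢ b → ⊥
    no-path {a} {x} {y} {b} a≢b da≡db ax xy yb a≢y x≢b = noP3 (a , b , a≢b , da≡db , record
      { x = x ; y = y ; a≢x = ∼⇒≢ ax ; a≢y = a≢y ; a≢b = a≢b ; x≢y = ∼⇒≢ xy ; x≢b = x≢b
      ; y≢b = ∼⇒≢ yb ; ax = ax ; xy = xy ; yb = yb })

  -- Every y outside {a, b, x} is adjacent to at most one of x and b, since
  -- otherwise a x y b would be a forbidden path.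
  twin-bound : ∀ {a b x} → a ≢ b → d a ≡ d b → a ∼ x → x ≢ b →
    2 + (d a + d x) ≤ V + ([ a ∼? b ] + 2 * [ b ∼? x ])
  twin-bound {a} {b} {x} a≢b da≡db ax x≢b = begin
    2 + (d a + d x)
      ≡⟨ ≡.trans (cong (λ z → 2 + (z + d x)) da≡db) (shuffle (d b) (d x)) ⟩
    (d x + d b) + (1 + 1)
      ≡⟨ cong₂ _+_ (cong₂ _+_ (degree≡count x) (degree≡count b))
                   (cong₂ _+_ (≡.sym (count-≡ x)) (≡.sym (count-≡ b))) ⟩
    (count (x ∼?_) + count (b ∼?_)) + (count (_≟ x) + count (_≟ b))
      ≡⟨ cong₂ _+_ (∑-distrib-+ (λ y → [ x ∼? y ]) (λ y → [ b ∼? y ])) (∑-distrib-+ (λ y → [ y ≟ x ]) (λ y → [ y ≟ b ])) ⟨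
    sum (λ y → [ x ∼? y ] + [ b ∼? y ]) + sum (λ y → [ y ≟ x ] + [ y ≟ b ])
      ≡⟨ ∑-distrib-+ (λ y → [ x ∼? y ] + [ b ∼? y ]) (λ y → [ y ≟ x ] + [ y ≟ b ]) ⟨
    sum (λ y → ([ x ∼? y ] + [ b ∼? y ]) + ([ y ≟ x ] + [ y ≟ b ]))
      ≤⟨ sum-mono pointwise ⟩
    -- The markers count 1 at `x` and at `b`; the corrections allow for `b ∼ a` at `y = a`, and for
    -- `b ∼ x` at `y = x` and `y = b`.
    sum (λ y → 1 + ([ y ≟ a ] * ab + ([ y ≟ x ] * bx + [ y ≟ b ] * bx)))
      ≡⟨ ∑-distrib-+ (λ _ → 1) (λ y → [ y ≟ a ] * ab + ([ y ≟ x ] * bx + [ y ≟ b ] * bx)) ⟩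
    sum {V} (λ _ → 1) + sum (λ y → [ y ≟ a ] * ab + ([ y ≟ x ] * bx + [ y ≟ b ] * bx))
      ≡⟨ cong₂ _+_ (≡.trans (sum-const V 1) (*-identityʳ V))
           (≡.trans (∑-distrib-+ (λ y → [ y ≟ a ] * ab) (λ y → [ y ≟ x ] * bx + [ y ≟ b ] * bx))
           (cong₂ _+_ (weight a ab)
             (≡.trans (∑-distrib-+ (λ y → [ y ≟ x ] * bx) (λ y → [ y ≟ b ] * bx))
                      (cong₂ _+_ (weight x bx) (weight b bx))))) ⟩
    V + (ab + (bx + bx))
      ≡⟨ cong (λ z → V + (ab + (bx + z))) (≡.sym (+-identityʳ bx)) ⟩
    V + (ab + 2 * bx) ∎
    where
      open ≤-Reasoning
      ab = [ a ∼? b ]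
      bx = [ b ∼? x ]
      shuffle : ∀ p q → 2 + (p + q) ≡ (q + p) + (1 + 1)
      shuffle = solve-∀
      weight : ∀ i c → sum (λ y → [ y ≟ i ] * c) ≡ c
      weight i c = ≡.trans (≡.sym (*-distribʳ-sum c (λ y → [ y ≟ i ])))
                           (≡.trans (cong (_* c) (count-≡ i)) (*-identityˡ c))
      pointwise : ∀ y → ([ x ∼? y ] + [ b ∼? y ]) + ([ y ≟ x ] + [ y ≟ b ])
                      ≤ 1 + ([ y ≟ a ] * ab + ([ y ≟ x ] * bx + [ y ≟ b ] * bx))
      pointwise y with y ≟ a | y ≟ x | y ≟ b
      ... | yes refl | yes refl | _        = ⊥-elim (∼-irrefl ax)
      ... | yes refl | _        | yes refl = ⊥-elim (a≢b refl)
      ... | _        | yes refl | yes refl = ⊥-elim (x≢b refl)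
      ... | yes refl | no _     | no _     rewrite [∼]-sym b a | +-identityʳ ab | +-identityʳ ab =
        ≤-trans (≤-reflexive (+-identityʳ _)) (+-monoˡ-≤ ab ([]≤1 (x ∼? a)))
      ... | no _     | yes refl | no _     rewrite []-no (x ∼? x) ∼-irrefl | +-identityʳ bx | +-identityʳ bx = ≤-reflexive (+-comm bx 1)
      ... | no _     | no _     | yes refl rewrite []-no (b ∼? b) ∼-irrefl | [∼]-sym x b | +-identityʳ bx = ≤-reflexive (+-comm bx 1)
      ... | no y≢a   | no y≢x   | no y≢b   with x ∼? y | b ∼? y
      ...   | yes xy | yes by = ⊥-elim (no-path a≢b da≡db ax xy (∼-sym by) (y≢a ∘ ≡.sym) x≢b)
      ...   | yes _  | no _   = ≤-refl
      ...   | no _   | yes _  = ≤-refl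
      ...   | no _   | no _   = z≤n

  excess≥3 : ∀ {t k} → 2 + t ≤ V + k → V < t → 3 ≤ k
  excess≥3 {t} {k} bound heavy = +-cancelˡ-≤ V 3 k (begin
    V + 3        ≡⟨ +-comm V 3 ⟩
    2 + suc V    ≤⟨ +-monoʳ-≤ 2 heavy ⟩
    2 + t        ≤⟨ bound ⟩
    V + k        ∎)
    where open ≤-Reasoning

  -- The bracket `[ a ∼? b ] + 2 * [ b ∼? x ]` of `twin-bound` never exceeds 3, and a surplus forces
  -- it to be at least 3. So both adjacencies hold and the surplus is exactly one.
  heavy-twin : ∀ {a b x} → a ≢ b → d a ≡ d b → a ∼ x → x ≢ b → V < d a + d x →
    a ∼ b × x ∼ b × d a + d x ≡ suc V
  heavy-twin {a} {b} {x} a≢b da≡db ax x≢b heavy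
    with a ∼? b | b ∼? x | twin-bound a≢b da≡db ax x≢b
  ... | yes ab | yes bx | bound = ab , ∼-sym bx ,
    ≤-antisym (+-cancelˡ-≤ 2 _ _ (≤-trans bound (≤-reflexive (+-comm V 3)))) heavy
  ... | yes _ | no _  | bound with s≤s () ← excess≥3 bound heavy
  ... | no _  | yes _ | bound with s≤s (s≤s ()) ← excess≥3 bound heavy
  ... | no _  | no _  | bound with () ← excess≥3 bound heavy

  far-twin⇒light : ∀ {a b x} → a ≢ b → d a ≡ d b → a ∼ x → x ≢ b → ¬ b ∼ x → d a + d x < V
  far-twin⇒light {a} {b} {x} a≢b da≡db ax x≢b ¬bx = +-cancelˡ-≤ 1 _ _ (begin
    2 + (d a + d x)                        ≤⟨ twin-bound a≢b da≡db ax x≢b ⟩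
    V + ([ a ∼? b ] + 2 * [ b ∼? x ])      ≡⟨ cong (λ z → V + ([ a ∼? b ] + 2 * z)) ([]-no (b ∼? x) ¬bx) ⟩
    V + ([ a ∼? b ] + 0)                   ≤⟨ +-monoʳ-≤ V (+-monoˡ-≤ 0 ([]≤1 (a ∼? b))) ⟩
    V + 1                                  ≡⟨ +-comm V 1 ⟩
    1 + V                                  ∎)
    where open ≤-Reasoning

  -- `heavy-twin` for the pair `w`, `w′`, with their common neighbour `v` in the role of `x`.
  twin-neighbours : ∀ {v w w′} → v ∼ w → v ∼ w′ → w ≢ w′ → d w ≡ d w′ → V < d v + d w →
    w ∼ w′ × d v + d w ≡ suc V
  twin-neighbours {v} {w} vw vw′ w≢w′ dw≡dw′ heavy
    with ww′ , _ , sum≡ ← heavy-twin w≢w′ dw≡dw′ (∼-sym vw) (∼⇒≢ vw′) (subst (V <_) (+-comm (d v) (d w)) heavy)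
    = ww′ , ≡.trans (+-comm (d v) (d w)) sum≡

  -- `w″` and `w′` are adjacent by `twin-neighbours`, so `w v w″ w′` is a forbidden path.
  no-three-twins : ∀ {v w w′ w″} → v ∼ w → v ∼ w′ → v ∼ w″ → w ≢ w′ → w ≢ w″ → w′ ≢ w″ →
    d w ≡ d w′ → d w ≡ d w″ → V < d v + d w → ⊥
  no-three-twins {v} {w} {w′} {w″} vw vw′ vw″ w≢w′ w≢w″ w′≢w″ e e″ heavy =
    no-path w≢w′ e (∼-sym vw) vw″ w″w′ w≢w″ (∼⇒≢ vw′)
    where
      w″w′ : w″ ∼ w′
      w″w′ = ∼-sym (proj₁ (twin-neighbours vw′ vw″ w′≢w″ (≡.trans (≡.sym e) e″) (subst (λ z → V < d v + z) e heavy)))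

  -- Otherwise `w a b w′` is a forbidden path.
  common-neighbours-distinct : ∀ {a b w w′} → a ∼ b → a ∼ w → b ∼ w′ → w ≢ w′ → w ≢ b → w′ ≢ a → d w ≢ d w′
  common-neighbours-distinct ab aw bw′ w≢w′ w≢b w′≢a dw≡dw′ =
    no-path w≢w′ dw≡dw′ (∼-sym aw) ab bw′ w≢b (w′≢a ∘ ≡.sym)

  -- A vertex `y` outside the triangle that is adjacent to two corners `p` and `q` gives the path
  -- `p y q r` to the third corner. So outside vertices count at most once, and corners twice.
  equal-degree-triangle : ∀ {a b c} → a ∼ b → b ∼ c → c ∼ a → d a ≡ d b → d b ≡ d c →
    d a + (d b + d c) ≤ V + 3
  equal-degree-triangle {a} {b} {c} ab bc ca da≡db db≡dc = begin
    d a + (d b + d c)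
      ≡⟨ cong₂ _+_ (degree≡count a) (cong₂ _+_ (degree≡count b) (degree≡count c)) ⟩
    count (a ∼?_) + (count (b ∼?_) + count (c ∼?_))
      ≡⟨ sum₃ (λ y → [ a ∼? y ]) (λ y → [ b ∼? y ]) (λ y → [ c ∼? y ]) ⟨
    sum (λ y → [ a ∼? y ] + ([ b ∼? y ] + [ c ∼? y ]))
      ≤⟨ sum-mono pointwise ⟩
    sum (λ y → 1 + ([ y ≟ a ] + ([ y ≟ b ] + [ y ≟ c ])))
      ≡⟨ ∑-distrib-+ (λ _ → 1) (λ y → [ y ≟ a ] + ([ y ≟ b ] + [ y ≟ c ])) ⟩
    sum {V} (λ _ → 1) + sum (λ y → [ y ≟ a ] + ([ y ≟ b ] + [ y ≟ c ]))
      ≡⟨ cong₂ _+_ (≡.trans (sum-const V 1) (*-identityʳ V))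
           (≡.trans (sum₃ (λ y → [ y ≟ a ]) (λ y → [ y ≟ b ]) (λ y → [ y ≟ c ]))
                    (cong₂ _+_ (count-≡ a) (cong₂ _+_ (count-≡ b) (count-≡ c)))) ⟩
    V + 3 ∎
    where
      open ≤-Reasoning
      sum₃ : ∀ (f g h : Fin V → ℕ) → sum (λ y → f y + (g y + h y)) ≡ sum f + (sum g + sum h)
      sum₃ f g h = ≡.trans (∑-distrib-+ f (λ y → g y + h y)) (cong (sum f +_) (∑-distrib-+ g h))
      no-shared : ∀ {p q r y} → p ≢ q → q ∼ r → r ∼ p → d p ≡ d r → p ∼ y → y ∼ q → y ≢ r → ⊥
      no-shared p≢q qr rp dp≡dr py yq y≢r =
        no-path (∼⇒≢ rp ∘ ≡.sym) dp≡dr py yq qr p≢q y≢r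
      pointwise : ∀ y → [ a ∼? y ] + ([ b ∼? y ] + [ c ∼? y ]) ≤ 1 + ([ y ≟ a ] + ([ y ≟ b ] + [ y ≟ c ]))
      pointwise y with y ≟ a | y ≟ b | y ≟ c
      ... | yes refl | _ | _ rewrite []-no (a ∼? a) ∼-irrefl =
        ≤-trans (+-mono-≤ ([]≤1 (b ∼? a)) ([]≤1 (c ∼? a))) (m≤m+n 2 _)
      ... | no _ | yes refl | _ rewrite []-no (b ∼? b) ∼-irrefl =
        ≤-trans (+-mono-≤ ([]≤1 (a ∼? b)) ([]≤1 (c ∼? b))) (m≤m+n 2 _)
      ... | no _ | no _ | yes refl rewrite []-no (c ∼? c) ∼-irrefl | +-identityʳ [ b ∼? c ] =
        +-mono-≤ ([]≤1 (a ∼? c)) ([]≤1 (b ∼? c))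
      ... | no y≢a | no y≢b | no y≢c with a ∼? y | b ∼? y | c ∼? y
      ...   | yes ay | yes by | _ = ⊥-elim (no-shared (∼⇒≢ ab) bc ca (≡.trans da≡db db≡dc) ay (∼-sym by) y≢c)
      ...   | yes ay | no _ | yes cy = ⊥-elim (no-shared (∼⇒≢ ca ∘ ≡.sym) (∼-sym bc) (∼-sym ab) da≡db ay (∼-sym cy) y≢b)
      ...   | no _ | yes by | yes cy = ⊥-elim (no-shared (∼⇒≢ bc) ca ab (≡.sym da≡db) by (∼-sym cy) y≢a)
      ...   | yes _ | no _ | no _ = ≤-refl
      ...   | no _ | yes _ | no _ = ≤-refl
      ...   | no _ | no _ | yes _ = ≤-refl
      ...   | no _ | no _ | no _ = z≤n

-- The surplus identity

module Energy (n : ℕ) (G : Graph (n + (n + 1))) where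
  open Adjacency G

  V : ℕ
  V = n + (n + 1)

  -- (e - n)(e - n - 1) in truncated subtraction: the first summand vanishes for `e ≤ n`, the second
  -- for `e ≥ n`.
  cost : ℕ → ℕ
  cost e = (e ∸ n) * (e ∸ suc n) + (n ∸ e) * (suc n ∸ e)

  cost-below : ∀ {e} → e ≤ n → cost e ≡ (n ∸ e) * (suc n ∸ e)
  cost-below {e} e≤n = cong (λ z → z * (e ∸ suc n) + (n ∸ e) * (suc n ∸ e)) (m≤n⇒m∸n≡0 e≤n)

  cost-above : ∀ i → cost (suc n + i) ≡ suc i * i
  cost-above i = begin
    (suc n + i ∸ n) * (suc n + i ∸ suc n) + (n ∸ (suc n + i)) * (suc n ∸ (suc n + i))
      ≡⟨ cong₂ _+_ (cong₂ _*_ (≡.trans (cong (_∸ n) (≡.sym (+-suc n i))) (m+n∸m≡n n (suc i))) (m+n∸m≡n (suc n) i))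
                   (cong (_* (suc n ∸ (suc n + i))) (m≤n⇒m∸n≡0 {n} (≤-trans (n≤1+n n) (m≤m+n (suc n) i)))) ⟩
    suc i * i + 0
      ≡⟨ +-identityʳ _ ⟩
    suc i * i ∎
    where open ≡.≡-Reasoning

  cost-quadratic : ∀ e → cost e + V * e ≡ e * e + n * suc n
  cost-quadratic e with ≤-<-connex e n
  ... | inj₁ e≤n with k , refl ← m≤n⇒∃[o]m+o≡n e≤n = begin
      cost e + (e + k + (e + k + 1)) * e
        ≡⟨ cong (_+ (e + k + (e + k + 1)) * e) (cost-below e≤n) ⟩
      (e + k ∸ e) * (suc (e + k) ∸ e) + (e + k + (e + k + 1)) * e
        ≡⟨ cong₂ (λ x y → x * y + (e + k + (e + k + 1)) * e) (m+n∸m≡n e k) (≡.trans (cong (_∸ e) (≡.sym (+-suc e k))) (m+n∸m≡n e (suc k))) ⟩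
      k * suc k + (e + k + (e + k + 1)) * e
        ≡⟨ poly e k ⟩
      e * e + (e + k) * suc (e + k) ∎
    where
      open ≡.≡-Reasoning
      poly : ∀ e k → k * suc k + (e + k + (e + k + 1)) * e ≡ e * e + (e + k) * suc (e + k)
      poly = solve-∀
  ... | inj₂ n<e with k , refl ← m≤n⇒∃[o]m+o≡n n<e =
      ≡.trans (cong (_+ V * (suc n + k)) (cost-above k)) (poly n k)
    where
      poly : ∀ n k → suc k * k + (n + (n + 1)) * (suc n + k) ≡ (suc n + k) * (suc n + k) + n * suc n
      poly = solve-∀

  -- Weight of an ordered pair: an edge is charged to its endpoint of larger
  -- degree, and split evenly in case of a tie.
  c : Fin V → Fin V → ℕ
  c v w = [ d w <? d v ] + [ d w ℕ.≤? d v ]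

  c-lower : ∀ {v w} → d w < d v → c v w ≡ 2
  c-lower {v} {w} lt = cong₂ _+_ ([]-yes (d w <? d v) lt) ([]-yes (d w ℕ.≤? d v) (<⇒≤ lt))

  c-tie : ∀ {v w} → d w ≡ d v → c v w ≡ 1
  c-tie {v} {w} eq = cong₂ _+_ ([]-no (d w <? d v) (<-irrefl eq)) ([]-yes (d w ℕ.≤? d v) (≤-reflexive eq))

  c-upper : ∀ {v w} → d v < d w → c v w ≡ 0
  c-upper {v} {w} gt = cong₂ _+_ ([]-no (d w <? d v) (<-asym gt)) ([]-no (d w ℕ.≤? d v) (<⇒≱ gt))

  c-sum : ∀ v w → c v w + c w v ≡ 2
  c-sum v w with <-cmp (d w) (d v)
  ... | tri< lt _ _ = cong₂ _+_ (c-lower lt) (c-upper lt)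
  ... | tri≈ _ eq _ = cong₂ _+_ (c-tie eq) (c-tie (≡.sym eq))
  ... | tri> _ _ gt = cong₂ _+_ (c-upper gt) (c-lower gt)

  ∑∑ : (Fin V → Fin V → ℕ) → ℕ
  ∑∑ φ = sum (λ v → sum (φ v))

  ∑∑-cong : ∀ {φ ψ} → (∀ v w → φ v w ≡ ψ v w) → ∑∑ φ ≡ ∑∑ ψ
  ∑∑-cong eq = sum-cong-≗ λ v → sum-cong-≗ (eq v)

  ∑∑-+ : ∀ φ ψ → ∑∑ (λ v w → φ v w + ψ v w) ≡ ∑∑ φ + ∑∑ ψ
  ∑∑-+ φ ψ = ≡.trans (sum-cong-≗ λ v → ∑-distrib-+ (φ v) (ψ v)) (∑-distrib-+ (λ v → sum (φ v)) (λ v → sum (ψ v)))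

  -- Exchanging the summation variables averages `c v w` with `c w v`, and these add up to 2.
  c-weighted : ∀ φ → (∀ v w → φ v w ≡ φ w v) → ∑∑ (λ v w → c v w * φ v w) ≡ ∑∑ φ
  c-weighted φ φ-sym = *-cancelˡ-≡ _ _ 2 (begin
    2 * S                                          ≡⟨ cong (S +_) (+-identityʳ S) ⟩
    S + S                                          ≡⟨ cong (S +_) (∑-comm (λ v w → c v w * φ v w)) ⟩
    S + ∑∑ (λ v w → c w v * φ w v)                 ≡⟨ ∑∑-+ (λ v w → c v w * φ v w) (λ v w → c w v * φ w v) ⟨
    ∑∑ (λ v w → c v w * φ v w + c w v * φ w v)     ≡⟨ ∑∑-cong pointwise ⟩
    ∑∑ (λ v w → φ v w + φ v w)                     ≡⟨ ∑∑-+ φ φ ⟩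
    ∑∑ φ + ∑∑ φ                                    ≡⟨ cong (∑∑ φ +_) (+-identityʳ _) ⟨
    2 * ∑∑ φ                                       ∎)
    where
      open ≡.≡-Reasoning
      S = ∑∑ (λ v w → c v w * φ v w)
      pointwise : ∀ v w → c v w * φ v w + c w v * φ w v ≡ φ v w + φ v w
      pointwise v w = begin
        c v w * φ v w + c w v * φ w v   ≡⟨ cong (λ z → c v w * φ v w + c w v * z) (φ-sym w v) ⟩
        c v w * φ v w + c w v * φ v w   ≡⟨ *-distribʳ-+ (φ v w) (c v w) (c w v) ⟨
        (c v w + c w v) * φ v w         ≡⟨ cong (_* φ v w) (c-sum v w) ⟩
        φ v w + (φ v w + 0)             ≡⟨ cong (φ v w +_) (+-identityʳ _) ⟩
        φ v w + φ v w                   ∎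

  surplus deficit : Fin V → Fin V → ℕ
  surplus v w = [ v ∼? w ] * (d v + d w ∸ V)
  deficit v w = [ v ∼? w ] * (V ∸ (d v + d w))

  surplus-sym : ∀ v w → surplus v w ≡ surplus w v
  surplus-sym v w = cong₂ (λ x y → x * (y ∸ V)) ([∼]-sym v w) (+-comm (d v) (d w))

  deficit-sym : ∀ v w → deficit v w ≡ deficit w v
  deficit-sym v w = cong₂ (λ x y → x * (V ∸ y)) ([∼]-sym v w) (+-comm (d v) (d w))

  P M : Fin V → ℕ
  P v = sum (λ w → c v w * surplus v w)
  M v = sum (λ w → c v w * deficit v w)

  ∑-adjacent : ∀ v x → sum (λ w → [ v ∼? w ] * x) ≡ d v * x
  ∑-adjacent v x = ≡.trans (≡.sym (*-distribʳ-sum x (λ w → [ v ∼? w ]))) (cong (_* x) (≡.sym (degree≡count v)))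

  -- On each edge, surplus - deficit = d v + d w - V. Over ordered adjacent pairs each of the two
  -- degrees sums to ∑ d², and the constant to `V * sum d`.
  surplus-deficit : sum P + V * sum d ≡ 2 * sum (λ v → d v * d v) + sum M
  surplus-deficit = begin
    sum P + V * sum d
      ≡⟨ cong₂ _+_ (c-weighted surplus surplus-sym) edges*V ⟩
    ∑∑ surplus + ∑∑ (λ v w → [ v ∼? w ] * V)
      ≡⟨ ∑∑-+ surplus (λ v w → [ v ∼? w ] * V) ⟨
    ∑∑ (λ v w → surplus v w + [ v ∼? w ] * V)
      ≡⟨ ∑∑-cong pointwise ⟩
    ∑∑ (λ v w → ([ v ∼? w ] * d v + [ v ∼? w ] * d w) + deficit v w)
      ≡⟨ ∑∑-+ (λ v w → [ v ∼? w ] * d v + [ v ∼? w ] * d w) deficit ⟩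
    ∑∑ (λ v w → [ v ∼? w ] * d v + [ v ∼? w ] * d w) + ∑∑ deficit
      ≡⟨ cong₂ _+_ (≡.trans (∑∑-+ (λ v w → [ v ∼? w ] * d v) (λ v w → [ v ∼? w ] * d w))
                     (≡.trans (cong₂ _+_ squares squares′) (cong (sum (λ v → d v * d v) +_) (≡.sym (+-identityʳ _)))))
                   (≡.sym (c-weighted deficit deficit-sym)) ⟩
    2 * sum (λ v → d v * d v) + sum M ∎
    where
      open ≡.≡-Reasoning
      edges*V : V * sum d ≡ ∑∑ (λ v w → [ v ∼? w ] * V)
      edges*V = ≡.trans (*-comm V (sum d)) (≡.trans (*-distribʳ-sum V d) (sum-cong-≗ λ v → ≡.sym (∑-adjacent v V)))
      squares : ∑∑ (λ v w → [ v ∼? w ] * d v) ≡ sum (λ v → d v * d v)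
      squares = sum-cong-≗ λ v → ∑-adjacent v (d v)
      squares′ : ∑∑ (λ v w → [ v ∼? w ] * d w) ≡ sum (λ v → d v * d v)
      squares′ = ≡.trans (∑-comm (λ v w → [ v ∼? w ] * d w))
                   (≡.trans (∑∑-cong (λ v w → cong (_* d v) ([∼]-sym w v))) squares)
      max : ∀ x y → (x ∸ y) + y ≡ x + (y ∸ x)
      max x y with ≤-total x y
      ... | inj₁ x≤y = ≡.trans (cong (_+ y) (m≤n⇒m∸n≡0 x≤y)) (≡.sym (m+[n∸m]≡n x≤y))
      ... | inj₂ y≤x = ≡.trans (m∸n+n≡m y≤x) (≡.trans (≡.sym (+-identityʳ x)) (cong (x +_) (≡.sym (m≤n⇒m∸n≡0 y≤x))))
      distrib : ∀ a s x → a * s + a * x ≡ a * (s + x)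
      distrib = solve-∀
      distrib₃ : ∀ a x y z → a * ((x + y) + z) ≡ (a * x + a * y) + a * z
      distrib₃ = solve-∀
      pointwise : ∀ v w → surplus v w + [ v ∼? w ] * V ≡ ([ v ∼? w ] * d v + [ v ∼? w ] * d w) + deficit v w
      pointwise v w = ≡.trans (distrib [ v ∼? w ] _ V)
        (≡.trans (cong ([ v ∼? w ] *_) (max (d v + d w) V)) (distrib₃ [ v ∼? w ] (d v) (d w) _))

  total-cost : sum (cost ∘ d) + V * sum d ≡ sum (λ v → d v * d v) + V * (n * suc n)
  total-cost = begin
    sum (cost ∘ d) + V * sum d                       ≡⟨ cong (sum (cost ∘ d) +_) (*-distribˡ-sum V d) ⟩
    sum (cost ∘ d) + sum (λ v → V * d v)             ≡⟨ ∑-distrib-+ (cost ∘ d) (λ v → V * d v) ⟨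
    sum (λ v → cost (d v) + V * d v)                 ≡⟨ sum-cong-≗ (cost-quadratic ∘ d) ⟩
    sum (λ v → d v * d v + n * suc n)                ≡⟨ ∑-distrib-+ (λ v → d v * d v) (λ _ → n * suc n) ⟩
    sum (λ v → d v * d v) + sum {V} (λ _ → n * suc n) ≡⟨ cong (sum (λ v → d v * d v) +_) (sum-const V (n * suc n)) ⟩
    sum (λ v → d v * d v) + V * (n * suc n)          ∎
    where open ≡.≡-Reasoning

  -- Eliminates ∑ d² between `total-cost` and `surplus-deficit`. A lower bound on `sum d` now bounds
  -- costs and deficits by surpluses.
  balance : 2 * sum (cost ∘ d) + sum M + V * sum d ≡ sum P + V * (2 * (n * suc n))
  balance = +-cancelʳ-≡ (V * sum d + 2 * S₂) _ _ (lem C (sum M) (sum P) (V * sum d) S₂ (n * suc n) V total-cost surplus-deficit)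
    where
      C = sum (cost ∘ d)
      S₂ = sum (λ v → d v * d v)
      lem : ∀ C M P E S q V → C + E ≡ S + V * q → P + E ≡ 2 * S + M →
        2 * C + M + E + (E + 2 * S) ≡ P + V * (2 * q) + (E + 2 * S)
      lem C M P E S q V e₁ e₂ = begin
        2 * C + M + E + (E + 2 * S)   ≡⟨ p₁ C M E S ⟩
        2 * (C + E) + (2 * S + M)     ≡⟨ cong₂ (λ x y → 2 * x + y) e₁ (≡.sym e₂) ⟩
        2 * (S + V * q) + (P + E)     ≡⟨ p₂ P E S q V ⟩
        P + V * (2 * q) + (E + 2 * S) ∎
        where
          open ≡.≡-Reasoning
          p₁ : ∀ C M E S → 2 * C + M + E + (E + 2 * S) ≡ 2 * (C + E) + (2 * S + M)
          p₁ = solve-∀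
          p₂ : ∀ P E S q V → 2 * (S + V * q) + (P + E) ≡ P + V * (2 * q) + (E + 2 * S)
          p₂ = solve-∀

-- Surplus charged to a single vertex

-- Neighbours of v of the same degree can only occur along edges of surplus one,
-- that is at level 0 below, and then at most two of them.
cap : ℕ → ℕ
cap zero    = 2
cap (suc _) = 1

-- The summand `B` on the left stands for the -1 in B (2 k + B - 1); the factor 1 is what `cap`
-- reduces to at positive levels.
arithmetic-series : ∀ k B → 2 * sum {B} (λ s → 1 * (k + toℕ s)) + B ≡ B * (2 * k + B)
arithmetic-series k zero    = refl
arithmetic-series k (suc B) = begin
  2 * (1 * (k + 0) + sum {B} (λ s → 1 * (k + suc (toℕ s)))) + suc B
    ≡⟨ cong (λ z → 2 * (1 * (k + 0) + z) + suc B) (sum-cong-≗ {B} (λ s → cong (1 *_) (+-suc k (toℕ s)))) ⟩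
  2 * (1 * (k + 0) + S) + suc B
    ≡⟨ p₁ k S B ⟩
  (2 * S + B) + (2 * k + 1)
    ≡⟨ cong (_+ (2 * k + 1)) (arithmetic-series (suc k) B) ⟩
  B * (2 * suc k + B) + (2 * k + 1)
    ≡⟨ p₂ k B ⟩
  suc B * (2 * k + suc B) ∎
  where
    open ≡.≡-Reasoning
    S = sum {B} (λ s → 1 * (suc k + toℕ s))
    p₁ : ∀ k S B → 2 * (1 * (k + 0) + S) + suc B ≡ (2 * S + B) + (2 * k + 1)
    p₁ = solve-∀
    p₂ : ∀ k B → B * (2 * suc k + B) + (2 * k + 1) ≡ suc B * (2 * k + suc B)
    p₂ = solve-∀

-- For positive `B` the sum is 1 + (1 + 2 + ... + B), the extra 1 coming from the doubled level 0.
cap-series : ∀ B → 2 * sum {B} (λ s → cap (toℕ s) * suc (toℕ s)) ≤ B * suc B + 2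
cap-series zero    = z≤n
cap-series (suc B) = ≤-reflexive (+-cancelʳ-≡ B _ _ (begin
  2 * (2 * 1 + S) + B                 ≡⟨ p₁ S B ⟩
  (2 * S + B) + 4                     ≡⟨ cong (_+ 4) (arithmetic-series 2 B) ⟩
  B * (2 * 2 + B) + 4                 ≡⟨ p₂ B ⟩
  suc B * suc (suc B) + 2 + B         ∎))
  where
    open ≡.≡-Reasoning
    S = sum {B} (λ s → 1 * (2 + toℕ s))
    p₁ : ∀ S B → 2 * (2 * 1 + S) + B ≡ (2 * S + B) + 4
    p₁ = solve-∀
    p₂ : ∀ B → B * (2 * 2 + B) + 4 ≡ suc B * suc (suc B) + 2 + B
    p₂ = solve-∀

∸-< : ∀ {m k} → k < m → m ∸ k ≡ suc (m ∸ suc k)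
∸-< {m} {k} k<m with j , refl ← m≤n⇒∃[o]m+o≡n k<m = begin
  suc k + j ∸ k            ≡⟨ cong (_∸ k) (+-suc k j) ⟨
  k + suc j ∸ k            ≡⟨ m+n∸m≡n k (suc j) ⟩
  suc j                    ≡⟨ cong suc (m+n∸m≡n (suc k) j) ⟨
  suc (suc k + j ∸ suc k)  ∎
  where open ≡.≡-Reasoning

module VertexBounds (n : ℕ) (G : Graph (n + (n + 1))) (noP3 : ¬ HasEqualDegreeP3 G) where
  open Adjacency G
  open NoEqualDegreeP3 G noP3
  open Energy n G

  1+n+n≡V : suc (n + n) ≡ V
  1+n+n≡V = lem n
    where
      lem : ∀ n → suc (n + n) ≡ n + (n + 1)
      lem = solve-∀

  Twin : Fin V → Set
  Twin v = ∃ λ b → b ≢ v × d b ≡ d v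

  Heavy : Fin V → Fin V → Set
  Heavy v w = v ∼ w × (d w < d v × V < d v + d w)

  heavy? : ∀ v w → Dec (Heavy v w)
  heavy? v w = (v ∼? w) ×-dec ((d w <? d v) ×-dec (V <? d v + d w))

  -- One less than the surplus, so that heavy neighbours start at level 0.
  level : Fin V → Fin V → ℕ
  level v w = d v + d w ∸ suc V

  level-injective : ∀ {v w w′} → V < d v + d w → V < d v + d w′ → level v w ≡ level v w′ → d w ≡ d w′
  level-injective {v} h h′ eq = +-cancelˡ-≡ (d v) _ _ (∸-cancelʳ-≡ h h′ eq)

  -- Equal levels mean equal degrees. `no-three-twins` excludes a third neighbour, and by
  -- `twin-neighbours` a second one occurs only at surplus one.
  heavy-cap : ∀ v s → count (λ w → heavy? v w ×-dec (level v w ℕ.≟ s)) ≤ cap s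
  heavy-cap v zero = count≤2 (λ w → heavy? v w ×-dec (level v w ℕ.≟ 0)) λ i j k ((vi , _ , hi) , li) ((vj , _ , hj) , lj) ((vk , _ , hk) , lk) i≢j i≢k j≢k →
    no-three-twins vi vj vk i≢j i≢k j≢k
      (level-injective hi hj (≡.trans li (≡.sym lj))) (level-injective hi hk (≡.trans li (≡.sym lk))) hi
  heavy-cap v (suc s) = count≤1 (λ w → heavy? v w ×-dec (level v w ℕ.≟ suc s)) uniq
    where
      uniq : ∀ i j → Heavy v i × level v i ≡ suc s → Heavy v j × level v j ≡ suc s → i ≡ j
      uniq i j ((vi , _ , hi) , li) ((vj , _ , hj) , lj) with i ≟ j
      ... | yes eq = eq
      ... | no i≢j with _ , sum≡ ← twin-neighbours vi vj i≢j (level-injective hi hj (≡.trans li (≡.sym lj))) hi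
        with () ← ≡.trans (≡.sym li) (≡.trans (cong (_∸ suc V) sum≡) (n∸n≡0 (suc V)))

  heavy-level< : ∀ {v w} ι → d v ≡ suc n + ι → Heavy v w → level v w < ι + ι
  heavy-level< {v} {w} ι dv≡ (_ , lt , h) = begin-strict
    d v + d w ∸ suc V                      <⟨ ∸-monoˡ-< (+-monoʳ-< (d v) lt) h ⟩
    d v + d v ∸ suc V                      ≡⟨ cong (λ z → z + z ∸ suc V) dv≡ ⟩
    (suc n + ι) + (suc n + ι) ∸ suc V      ≡⟨ cong (_∸ suc V) (poly n ι) ⟩
    suc V + (ι + ι) ∸ suc V                ≡⟨ m+n∸m≡n (suc V) (ι + ι) ⟩
    ι + ι                                  ∎
    where
      open ≤-Reasoning
      poly : ∀ n ι → (suc n + ι) + (suc n + ι) ≡ suc (n + (n + 1)) + (ι + ι)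
      poly = solve-∀

  surplus-light : ∀ {v w} → d v + d w ≤ V → surplus v w ≡ 0
  surplus-light {v} {w} le = ≡.trans (cong ([ v ∼? w ] *_) (m≤n⇒m∸n≡0 le)) (*-zeroʳ [ v ∼? w ])

  surplus-nonadjacent : ∀ {v w} → ¬ v ∼ w → surplus v w ≡ 0
  surplus-nonadjacent {v} {w} ¬vw = cong (_* (d v + d w ∸ V)) ([]-no (v ∼? w) ¬vw)

  surplus-adjacent : ∀ {v w} → v ∼ w → surplus v w ≡ d v + d w ∸ V
  surplus-adjacent {v} {w} vw = ≡.trans (cong (_* (d v + d w ∸ V)) ([]-yes (v ∼? w) vw)) (*-identityˡ _)

  surplus-heavy : ∀ {v w} → Heavy v w → surplus v w ≡ suc (level v w)
  surplus-heavy (vw , _ , h) = ≡.trans (surplus-adjacent vw) (∸-< h)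

  *-≡0 : ∀ k {m} → m ≡ 0 → k * m ≡ 0
  *-≡0 k eq = ≡.trans (cong (k *_) eq) (*-zeroʳ k)

  -- Edges charged to `v` have `d w ≤ d v ≤ n`, so their degree sum is at most 2 n < V.
  below-average : ∀ {v} → d v ≤ n → P v ≡ 0
  below-average {v} dv≤n = sum-zero pointwise
    where
      pointwise : ∀ w → c v w * surplus v w ≡ 0
      pointwise w with ≤-<-connex (d w) (d v)
      ... | inj₁ dw≤dv = *-≡0 (c v w) (surplus-light (begin
          d v + d w  ≤⟨ +-mono-≤ dv≤n (≤-trans dw≤dv dv≤n) ⟩
          n + n      ≤⟨ n≤1+n _ ⟩
          suc (n + n) ≡⟨ 1+n+n≡V ⟩
          V          ∎))
        where open ≤-Reasoning
      ... | inj₂ dv<dw = cong (_* surplus v w) (c-upper dv<dw)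

  -- Without a twin there are no ties, so each surplus edge charged to `v` leads to a heavy
  -- neighbour and has weight 2; `heavy-cap` limits how many there are at each level.
  twinless-bound : ∀ {v} ι → d v ≡ suc n + ι → ¬ Twin v →
    P v ≤ 2 * sum {ι + ι} (λ s → cap (toℕ s) * suc (toℕ s))
  twinless-bound {v} ι dv≡ ¬twin = begin
    P v
      ≤⟨ sum-mono pointwise ⟩
    sum (λ w → 2 * ([ heavy? v w ] * suc (level v w)))
      ≡⟨ *-distribˡ-sum 2 (λ w → [ heavy? v w ] * suc (level v w)) ⟨
    2 * sum (λ w → [ heavy? v w ] * suc (level v w))
      ≤⟨ *-monoʳ-≤ 2 (sum-level-bound (heavy? v) (level v) cap suc (ι + ι) (λ _ → heavy-level< ι dv≡) (heavy-cap v)) ⟩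
    2 * sum {ι + ι} (λ s → cap (toℕ s) * suc (toℕ s)) ∎
    where
      open ≤-Reasoning
      pointwise : ∀ w → c v w * surplus v w ≤ 2 * ([ heavy? v w ] * suc (level v w))
      pointwise w = by-cases (v ∼? w) (<-cmp (d w) (d v)) (≤-<-connex (d v + d w) V)
        where
          zero-left : c v w * surplus v w ≡ 0 → c v w * surplus v w ≤ 2 * ([ heavy? v w ] * suc (level v w))
          zero-left eq = ≤-trans (≤-reflexive eq) z≤n
          by-cases : Dec (v ∼ w) → Tri (d w < d v) (d w ≡ d v) (d v < d w) → (d v + d w ≤ V) ⊎ (V < d v + d w) →
            c v w * surplus v w ≤ 2 * ([ heavy? v w ] * suc (level v w))
          by-cases (no ¬vw) _ _ = zero-left (*-≡0 (c v w) (surplus-nonadjacent ¬vw))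
          by-cases (yes vw) (tri≈ _ eq _) _ = ⊥-elim (¬twin (w , ∼⇒≢ vw ∘ ≡.sym , eq))
          by-cases (yes vw) (tri> _ _ gt) _ = zero-left (cong (_* surplus v w) (c-upper gt))
          by-cases (yes vw) (tri< lt _ _) (inj₁ le) = zero-left (*-≡0 (c v w) (surplus-light le))
          by-cases (yes vw) (tri< lt _ _) (inj₂ h) = ≤-reflexive (cong₂ _*_ (c-lower lt) (≡.trans (surplus-heavy (vw , lt , h))
            (≡.trans (≡.sym (*-identityˡ _)) (cong (_* suc (level v w)) (≡.sym ([]-yes (heavy? v w) (vw , lt , h)))))))

  -- `cap-series` gives 2 ι (2 ι + 1) + 2, which is twice the cost ι (ι + 1) plus 2 (ι² + 1).
  twinless-bound′ : ∀ {v} ι → d v ≡ suc n + ι → ¬ Twin v → P v ≤ 2 * cost (d v) + 2 * suc (ι * ι)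
  twinless-bound′ {v} ι dv≡ ¬twin = begin
    P v                                                  ≤⟨ twinless-bound ι dv≡ ¬twin ⟩
    2 * sum {ι + ι} (λ s → cap (toℕ s) * suc (toℕ s))    ≤⟨ cap-series (ι + ι) ⟩
    (ι + ι) * suc (ι + ι) + 2                            ≡⟨ poly ι ⟩
    2 * (suc ι * ι) + 2 * suc (ι * ι)                    ≡⟨ cong (λ z → 2 * z + 2 * suc (ι * ι)) (≡.trans (cong cost dv≡) (cost-above ι)) ⟨
    2 * cost (d v) + 2 * suc (ι * ι)                     ∎
    where
      open ≤-Reasoning
      poly : ∀ ι → (ι + ι) * suc (ι + ι) + 2 ≡ 2 * (suc ι * ι) + 2 * suc (ι * ι)
      poly = solve-∀

  -- At degree `n + 1` the sum in `twinless-bound` is empty.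
  twinless-active⇒ : ∀ {v} → ¬ Twin v → 0 < P v → ∃ λ κ → d v ≡ suc n + suc κ
  twinless-active⇒ {v} ¬twin 0<P with ≤-<-connex (d v) n
  ... | inj₁ dv≤n = ⊥-elim (n≮0 (subst (0 <_) (below-average dv≤n) 0<P))
  ... | inj₂ n<dv with m≤n⇒∃[o]m+o≡n n<dv
  ...   | zero  , eq = ⊥-elim (<⇒≱ 0<P (twinless-bound 0 (≡.sym eq) ¬twin))
  ...   | suc κ , eq = κ , ≡.sym eq

  -- Two adjacent vertices of equal degree above n

  module TwinPair (2≤n : 2 ≤ n) {a b} (ab : a ∼ b) (da≡db : d a ≡ d b) (ι : ℕ) (da≡ : d a ≡ suc n + ι) where

    a≢b : a ≢ b
    a≢b = ∼⇒≢ ab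

    da+da≡ : d a + d a ≡ suc V + (ι + ι)
    da+da≡ = ≡.trans (cong₂ _+_ da≡ da≡) (poly n ι)
      where
        poly : ∀ n ι → (suc n + ι) + (suc n + ι) ≡ suc (n + (n + 1)) + (ι + ι)
        poly = solve-∀

    V<da+da : V < d a + d a
    V<da+da = subst (V <_) (≡.sym da+da≡) (m≤m+n (suc V) (ι + ι))

    Tie Exact : Fin V → Set
    Tie w = a ∼ w × d w ≡ d a
    Exact w = a ∼ w × d a + d w ≡ V

    tie? : ∀ w → Dec (Tie w)
    tie? w = (a ∼? w) ×-dec (d w ℕ.≟ d a)

    exact? : ∀ w → Dec (Exact w)
    exact? w = (a ∼? w) ×-dec (d a + d w ℕ.≟ V)

    -- Two ties are adjacent by `twin-neighbours` and form an equal-degree triangle with `a`; then 3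
    -- (n + 1) ≤ V + 3 = 2 n + 4, contrary to `2 ≤ n`.
    ties≤1 : count tie? ≤ 1
    ties≤1 = count≤1 tie? uniq
      where
        uniq : ∀ i j → Tie i → Tie j → i ≡ j
        uniq i j (ai , di) (aj , dj) with i ≟ j
        ... | yes eq = eq
        ... | no i≢j = ⊥-elim (<⇒≱ 2≤n (+-cancelˡ-≤ (n + (n + 1) + 3) n 1 contra))
          where
            ij : i ∼ j
            ij = proj₁ (twin-neighbours ai aj i≢j (≡.trans di (≡.sym dj)) (subst (λ z → V < d a + z) (≡.sym di) V<da+da))
            triangle : d a + (d i + d j) ≤ V + 3
            triangle = equal-degree-triangle ai ij (∼-sym aj) (≡.sym di) (≡.trans di (≡.sym dj))
            contra : n + (n + 1) + 3 + n ≤ n + (n + 1) + 3 + 1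
            contra = begin
              n + (n + 1) + 3 + n                   ≤⟨ m≤m+n _ (3 * ι) ⟩
              n + (n + 1) + 3 + n + 3 * ι           ≡⟨ poly n ι ⟩
              suc ((suc n + ι) + ((suc n + ι) + (suc n + ι))) ≡⟨ cong suc (cong₂ _+_ da≡ (cong₂ _+_ (≡.trans di da≡) (≡.trans dj da≡))) ⟨
              suc (d a + (d i + d j))               ≤⟨ s≤s triangle ⟩
              suc (V + 3)                           ≡⟨ +-comm 1 (V + 3) ⟩
              n + (n + 1) + 3 + 1                   ∎
              where
                open ≤-Reasoning
                poly : ∀ n ι → n + (n + 1) + 3 + n + 3 * ι ≡ suc ((suc n + ι) + ((suc n + ι) + (suc n + ι)))
                poly = solve-∀

    heavy-exact : ∀ {w} → Heavy a w → d a + d w ≡ suc V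
    heavy-exact (aw , lt , h) = proj₂ (proj₂ (heavy-twin a≢b da≡db aw (λ { refl → <-irrefl (≡.sym da≡db) lt }) h))

    -- For distinct `w` and `w′`: if `b ∼ w′`, then `w a b w′` is a forbidden path; if not,
    -- `far-twin⇒light` gives `a w′` a deficit.
    common-unique : ∀ {w w′} → a ∼ w → a ∼ w′ → w ≢ b → w′ ≢ b → V ≤ d a + d w → d w ≡ d w′ → w ≡ w′
    common-unique {w} {w′} aw aw′ w≢b w′≢b V≤ dw≡dw′ with w ≟ w′
    ... | yes eq = eq
    ... | no w≢w′ with b ∼? w′
    ...   | yes bw′ = ⊥-elim (common-neighbours-distinct ab aw bw′ w≢w′ w≢b (∼⇒≢ aw′ ∘ ≡.sym) dw≡dw′)
    ...   | no ¬bw′ = ⊥-elim (<⇒≱ (far-twin⇒light a≢b da≡db aw′ w′≢b ¬bw′) (subst (λ z → V ≤ d a + z) dw≡dw′ V≤))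

    heavies≤1 : count (heavy? a) ≤ 1
    heavies≤1 = count≤1 (heavy? a) λ i j hi hj →
      common-unique (proj₁ hi) (proj₁ hj) (≢b hi) (≢b hj) (<⇒≤ (proj₂ (proj₂ hi)))
        (+-cancelˡ-≡ (d a) _ _ (≡.trans (heavy-exact hi) (≡.sym (heavy-exact hj))))
      where
        ≢b : ∀ {w} → Heavy a w → w ≢ b
        ≢b (_ , lt , _) refl = <-irrefl (≡.sym da≡db) lt

    exacts≤1 : count exact? ≤ 1
    exacts≤1 = count≤1 exact? λ i j ei ej →
      common-unique (proj₁ ei) (proj₁ ej) (≢b ei) (≢b ej) (≤-reflexive (≡.sym (proj₂ ei)))
        (+-cancelˡ-≡ (d a) _ _ (≡.trans (proj₂ ei) (≡.sym (proj₂ ej))))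
      where
        ≢b : ∀ {w} → Exact w → w ≢ b
        ≢b (_ , eq) refl = <-irrefl (≡.sym eq) (subst (λ z → V < d a + z) da≡db V<da+da)

    no-heavy : ι ≡ 0 → ∀ w → ¬ Heavy a w
    no-heavy refl w h@(_ , lt , _) = <-irrefl
      (+-cancelˡ-≡ (d a) _ _ (≡.trans (heavy-exact h) (≡.trans (≡.sym (+-identityʳ (suc V))) (≡.sym da+da≡)))) lt

    -- Otherwise each neighbour is a tie, heavy or exact, at most one of each kind and none heavy
    -- for `ι = 0`. That is at most 3 neighbours, or 2 for `ι = 0`, fewer than n + 1 + ι.
    light-neighbour : ∃ λ w → a ∼ w × d a + d w < V
    light-neighbour with any? (λ w → (a ∼? w) ×-dec (d a + d w <? V))
    ... | yes found = found
    ... | no none = ⊥-elim (absurd ι refl)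
      where
        classify : ∀ w → [ a ∼? w ] ≤ [ tie? w ] + ([ heavy? a w ] + [ exact? w ])
        classify w = go (a ∼? w) (<-cmp (d w) (d a)) (<-cmp (d a + d w) V)
          where
            go : Dec (a ∼ w) → Tri (d w < d a) (d w ≡ d a) (d a < d w) → Tri (d a + d w < V) (d a + d w ≡ V) (V < d a + d w) →
              [ a ∼? w ] ≤ [ tie? w ] + ([ heavy? a w ] + [ exact? w ])
            go (no ¬aw) _ _ = ≤-trans (≤-reflexive ([]-no (a ∼? w) ¬aw)) z≤n
            go (yes aw) (tri≈ _ eq _) _ = ≤-trans ([]≤1 (a ∼? w))
              (≤-trans (≤-reflexive (≡.sym ([]-yes (tie? w) (aw , eq)))) (m≤m+n _ _))
            go (yes aw) _ (tri< lt _ _) = ⊥-elim (none (w , aw , lt))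
            go (yes aw) _ (tri≈ _ eq _) = ≤-trans ([]≤1 (a ∼? w))
              (≤-trans (≤-reflexive (≡.sym ([]-yes (exact? w) (aw , eq)))) (≤-trans (m≤n+m _ [ heavy? a w ]) (m≤n+m _ [ tie? w ])))
            go (yes aw) (tri< lt _ _) (tri> _ _ h) = ≤-trans ([]≤1 (a ∼? w))
              (≤-trans (≤-reflexive (≡.sym ([]-yes (heavy? a w) (aw , lt , h)))) (≤-trans (m≤m+n _ _) (m≤n+m _ [ tie? w ])))
            -- A neighbour of larger degree would have a surplus above one, which `heavy-twin`
            -- excludes.
            go (yes aw) (tri> _ _ gt) (tri> _ _ h) = ⊥-elim (<-irrefl
              (≡.sym (proj₂ (proj₂ (heavy-twin a≢b da≡db aw (λ { refl → <-irrefl da≡db gt }) h))))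
              (≤-<-trans V<da+da (+-monoʳ-< (d a) gt)))
        da≤ : d a ≤ count tie? + (count (heavy? a) + count exact?)
        da≤ = begin
          d a                ≡⟨ degree≡count a ⟩
          count (a ∼?_)      ≤⟨ sum-mono classify ⟩
          sum (λ w → [ tie? w ] + ([ heavy? a w ] + [ exact? w ]))
            ≡⟨ ≡.trans (∑-distrib-+ (λ w → [ tie? w ]) (λ w → [ heavy? a w ] + [ exact? w ]))
                       (cong (count tie? +_) (∑-distrib-+ (λ w → [ heavy? a w ]) (λ w → [ exact? w ]))) ⟩
          count tie? + (count (heavy? a) + count exact?) ∎
          where open ≤-Reasoning
        absurd : ∀ i → ι ≡ i → ⊥
        absurd zero ι≡0 = <⇒≱ (s≤s 2≤n) (begin
          suc n                                          ≤⟨ m≤m+n (suc n) ι ⟩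
          suc n + ι                                      ≡⟨ da≡ ⟨
          d a                                            ≤⟨ da≤ ⟩
          count tie? + (count (heavy? a) + count exact?) ≤⟨ +-mono-≤ ties≤1 (+-mono-≤ (≤-reflexive (count-none (heavy? a) (no-heavy ι≡0))) exacts≤1) ⟩
          2                                              ∎)
          where open ≤-Reasoning
        absurd (suc i) ι≡ = <⇒≱ (s≤s (s≤s 2≤n)) (begin
          suc (suc n)                                    ≡⟨ +-comm 1 (suc n) ⟩
          suc n + 1                                      ≤⟨ +-monoʳ-≤ (suc n) (s≤s z≤n) ⟩
          suc n + suc i                                  ≡⟨ cong (suc n +_) ι≡ ⟨
          suc n + ι                                      ≡⟨ da≡ ⟨
          d a                                            ≤⟨ da≤ ⟩
          count tie? + (count (heavy? a) + count exact?) ≤⟨ +-mono-≤ ties≤1 (+-mono-≤ heavies≤1 exacts≤1) ⟩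
          3                                              ∎)
          where open ≤-Reasoning

    -- The light neighbour has smaller degree than `a`, so its deficit is charged to `a` with weight
    -- 2.
    M≥2 : 2 ≤ M a
    M≥2 with w , aw , light ← light-neighbour = begin
      2                              ≡⟨⟩
      2 * (1 * 1)                    ≤⟨ *-monoʳ-≤ 2 (*-monoʳ-≤ 1 (m<n⇒0<n∸m light)) ⟩
      2 * (1 * (V ∸ (d a + d w)))    ≡⟨ cong₂ (λ x y → x * (y * (V ∸ (d a + d w)))) (c-lower dw<da) ([]-yes (a ∼? w) aw) ⟨
      c a w * deficit a w            ≤⟨ term≤sum (λ w → c a w * deficit a w) w ⟩
      M a                            ∎
      where
        open ≤-Reasoning
        dw<da : d w < d a
        dw<da = +-cancelˡ-< (d a) _ _ (<-trans light V<da+da)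

    -- A heavy neighbour has surplus one and weight 2, a tie has surplus 2 ι + 1 and weight 1.
    P≤ : P a ≤ 2 * count (heavy? a) + suc (ι + ι) * count tie?
    P≤ = begin
      P a ≤⟨ sum-mono pointwise ⟩
      sum (λ w → 2 * [ heavy? a w ] + suc (ι + ι) * [ tie? w ])
        ≡⟨ ∑-distrib-+ (λ w → 2 * [ heavy? a w ]) (λ w → suc (ι + ι) * [ tie? w ]) ⟩
      sum (λ w → 2 * [ heavy? a w ]) + sum (λ w → suc (ι + ι) * [ tie? w ])
        ≡⟨ cong₂ _+_ (*-distribˡ-sum 2 (λ w → [ heavy? a w ])) (*-distribˡ-sum (suc (ι + ι)) (λ w → [ tie? w ])) ⟨
      2 * count (heavy? a) + suc (ι + ι) * count tie? ∎
      where
        open ≤-Reasoning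
        pointwise : ∀ w → c a w * surplus a w ≤ 2 * [ heavy? a w ] + suc (ι + ι) * [ tie? w ]
        pointwise w = go (a ∼? w) (<-cmp (d w) (d a)) (≤-<-connex (d a + d w) V)
          where
            zero-left : c a w * surplus a w ≡ 0 → c a w * surplus a w ≤ 2 * [ heavy? a w ] + suc (ι + ι) * [ tie? w ]
            zero-left eq = ≤-trans (≤-reflexive eq) z≤n
            go : Dec (a ∼ w) → Tri (d w < d a) (d w ≡ d a) (d a < d w) → (d a + d w ≤ V) ⊎ (V < d a + d w) →
              c a w * surplus a w ≤ 2 * [ heavy? a w ] + suc (ι + ι) * [ tie? w ]
            go (no ¬aw) _ _ = zero-left (*-≡0 (c a w) (surplus-nonadjacent ¬aw))
            go (yes aw) (tri> _ _ gt) _ = zero-left (cong (_* surplus a w) (c-upper gt))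
            go (yes aw) _ (inj₁ le) = zero-left (*-≡0 (c a w) (surplus-light le))
            go (yes aw) (tri< lt _ _) (inj₂ h) = begin
              c a w * surplus a w              ≡⟨ cong₂ _*_ (c-lower lt) (surplus-heavy hw) ⟩
              2 * suc (level a w)              ≡⟨ cong (λ z → 2 * suc (z ∸ suc V)) (heavy-exact hw) ⟩
              2 * suc (suc V ∸ suc V)          ≡⟨ cong (λ z → 2 * suc z) (n∸n≡0 (suc V)) ⟩
              2 * 1                            ≡⟨ cong (2 *_) ([]-yes (heavy? a w) hw) ⟨
              2 * [ heavy? a w ]               ≤⟨ m≤m+n (2 * [ heavy? a w ]) _ ⟩
              2 * [ heavy? a w ] + suc (ι + ι) * [ tie? w ] ∎
              where
                hw : Heavy a w
                hw = aw , lt , h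
            go (yes aw) (tri≈ _ eq _) (inj₂ h) = begin
              c a w * surplus a w              ≡⟨ cong₂ _*_ (c-tie eq) (surplus-adjacent aw) ⟩
              1 * (d a + d w ∸ V)              ≡⟨ *-identityˡ _ ⟩
              d a + d w ∸ V                    ≡⟨ cong (λ z → d a + z ∸ V) eq ⟩
              d a + d a ∸ V                    ≡⟨ cong (_∸ V) (≡.trans da+da≡ (≡.sym (+-suc V (ι + ι)))) ⟩
              V + suc (ι + ι) ∸ V              ≡⟨ m+n∸m≡n V _ ⟩
              suc (ι + ι)                      ≡⟨ *-identityʳ _ ⟨
              suc (ι + ι) * 1                  ≡⟨ cong (suc (ι + ι) *_) ([]-yes (tie? w) (aw , eq)) ⟨
              suc (ι + ι) * [ tie? w ]         ≤⟨ m≤n+m _ (2 * [ heavy? a w ]) ⟩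
              2 * [ heavy? a w ] + suc (ι + ι) * [ tie? w ] ∎

    -- `P a` is at most 1 for `ι = 0` and at most 2 ι + 3 otherwise, against at least 2 ι (ι + 1) +
    -- 2 on the right.
    P<2cost+M : P a < 2 * cost (d a) + M a
    P<2cost+M = ≤-<-trans P≤ (begin-strict
      2 * count (heavy? a) + suc (ι + ι) * count tie?  ≤⟨ +-monoʳ-≤ (2 * count (heavy? a)) (*-monoʳ-≤ (suc (ι + ι)) ties≤1) ⟩
      2 * count (heavy? a) + suc (ι + ι) * 1           <⟨ by-ι ι refl ⟩
      2 * (suc ι * ι) + 2                              ≡⟨ cong (λ z → 2 * z + 2) (≡.trans (cong cost da≡) (cost-above ι)) ⟨
      2 * cost (d a) + 2                               ≤⟨ +-monoʳ-≤ _ M≥2 ⟩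
      2 * cost (d a) + M a                             ∎)
      where
        open ≤-Reasoning
        by-ι : ∀ i → ι ≡ i → 2 * count (heavy? a) + suc (i + i) * 1 < 2 * (suc i * i) + 2
        by-ι zero    ι≡0 = s≤s (≤-reflexive (cong (λ z → 2 * z + 1) (count-none (heavy? a) (no-heavy ι≡0))))
        by-ι (suc i) _   = ≤-<-trans (+-monoˡ-≤ _ (*-monoʳ-≤ 2 heavies≤1))
          (≤-from (2 * (i * i) + 4 * i) _ _ (z≤n {0}) (poly i))
          where
            poly : ∀ i → suc (2 * 1 + suc (suc i + suc i) * 1) + 0 + (2 * (i * i) + 4 * i) ≡ 2 * (suc (suc i) * suc i) + 2 + 0
            poly = solve-∀

  no-surplus : ∀ {v} → (∀ w → v ∼ w → d v + d w ≤ V) → P v ≡ 0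
  no-surplus {v} light = sum-zero λ w → *-≡0 (c v w) (go w (v ∼? w))
    where
      go : ∀ w → Dec (v ∼ w) → surplus v w ≡ 0
      go w (yes vw) = surplus-light (light w vw)
      go w (no ¬vw) = surplus-nonadjacent ¬vw

  -- As `P a` is positive, `a` has an edge with a surplus, and `heavy-twin` then makes the twin
  -- adjacent to `a`, as `TwinPair` requires.
  twin-vertex-bound : 2 ≤ n → ∀ {a} → n < d a → Twin a → 0 < P a → P a < 2 * cost (d a) + M a
  twin-vertex-bound 2≤n {a} n<da (b , b≢a , db≡da) 0<P
    with ι , suc-n+ι≡da ← m≤n⇒∃[o]m+o≡n n<da
    with any? (λ w → (a ∼? w) ×-dec (V <? d a + d w)) | a ∼? b
  ... | _ | yes ab = TwinPair.P<2cost+M 2≤n ab (≡.sym db≡da) ι (≡.sym suc-n+ι≡da)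
  ... | no none | no _ = ⊥-elim (<-irrefl (≡.sym (no-surplus λ w aw → ≮⇒≥ λ h → none (w , aw , h))) 0<P)
  ... | yes (w , aw , h) | no ¬ab with w ≟ b
  ...   | yes refl = ⊥-elim (¬ab aw)
  ...   | no w≢b = ⊥-elim (¬ab (proj₁ (heavy-twin (b≢a ∘ ≡.sym) (≡.sym db≡da) aw w≢b h)))

-- The active vertex of largest degree

maximal : ∀ {m p} {Q : Pred (Fin m) p} → Decidable Q → (f : Fin m → ℕ) → ∃ Q →
  ∃ λ u → Q u × (∀ v → Q v → f v ≤ f u)
maximal {m} Q? f (v₀ , q₀) = u ,
  Extrema.argmax-all f q₀ (all-filter Q? (allFin m)) ,
  λ v q → All.lookup (Extrema.f[xs]≤f[argmax] v₀ _) (∈-filter⁺ Q? (∈-allFin v) q)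
  where
    u = Extrema.argmax f v₀ (filter Q? (allFin m))

module Extremal (n : ℕ) (2≤n : 2 ≤ n) (G : Graph (n + (n + 1))) (noP3 : ¬ HasEqualDegreeP3 G) where
  open Adjacency G
  open NoEqualDegreeP3 G noP3
  open Energy n G
  open VertexBounds n G noP3

  twin? : ∀ v → Dec (Twin v)
  twin? v = any? λ b → ¬? (b ≟ v) ×-dec (d b ℕ.≟ d v)

  -- Only these vertices can be charged more than they pay. Having no twins, they have distinct
  -- degrees.
  Active : Fin V → Set
  Active v = ¬ Twin v × 0 < P v

  active? : ∀ v → Dec (Active v)
  active? v = ¬? (twin? v) ×-dec (0 <? P v)

  negcost : ℕ → ℕ
  negcost e = (n ∸ e) * (suc n ∸ e)

  below? : ∀ v → Dec (d v ≤ n)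
  below? v = d v ℕ.≤? n

  -- With `negcost`, the payment of vertices of degree at most `n`. Nothing is charged to those, so
  -- it serves as a reserve to cover the excesses.
  M⁻ : Fin V → ℕ
  M⁻ v = [ below? v ] * M v

  excess : Fin V → ℕ
  excess v = [ active? v ] * suc ((d v ∸ suc n) * (d v ∸ suc n))

  inactive-bound : ∀ {v} → ¬ Active v → P v ≡ 0 ⊎ P v < 2 * cost (d v) + M v
  inactive-bound {v} ¬active with ≤-<-connex (d v) n | 0 <? P v | twin? v
  ... | inj₁ dv≤n | _ | _ = inj₁ (below-average dv≤n)
  ... | inj₂ _ | no P≯0 | _ = inj₁ (n≤0⇒n≡0 (≮⇒≥ P≯0))
  ... | inj₂ n<dv | yes 0<P | yes twin = inj₂ (twin-vertex-bound 2≤n n<dv twin 0<P)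
  ... | inj₂ _ | yes 0<P | no ¬twin = ⊥-elim (¬active (¬twin , 0<P))

  inactive-≤ : ∀ {v} → ¬ Active v → P v ≤ 2 * cost (d v) + M v
  inactive-≤ ¬active with inactive-bound ¬active
  ... | inj₁ eq = ≤-trans (≤-reflexive eq) z≤n
  ... | inj₂ lt = <⇒≤ lt

  -- Up to degree `n`, `P v` is zero and the reserve is part of the payment. Above `n` the reserve
  -- is zero, and `excess` covers the active vertices.
  vertex-bound : ∀ v → P v + (2 * negcost (d v) + M⁻ v) ≤ (2 * cost (d v) + M v) + 2 * excess v
  vertex-bound v with ≤-<-connex (d v) n
  ... | inj₁ dv≤n = begin
      P v + (2 * negcost (d v) + M⁻ v)   ≡⟨ cong₂ (λ x y → x + (2 * y + M⁻ v)) (below-average dv≤n) (≡.sym (cost-below dv≤n)) ⟩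
      2 * cost (d v) + M⁻ v              ≤⟨ +-monoʳ-≤ (2 * cost (d v)) (*-monoˡ-≤ (M v) ([]≤1 (below? v))) ⟩
      2 * cost (d v) + (M v + 0)         ≡⟨ cong (2 * cost (d v) +_) (+-identityʳ (M v)) ⟩
      2 * cost (d v) + M v               ≤⟨ m≤m+n _ _ ⟩
      (2 * cost (d v) + M v) + 2 * excess v ∎
    where open ≤-Reasoning
  ... | inj₂ n<dv = begin
      P v + (2 * negcost (d v) + M⁻ v)   ≡⟨ cong₂ (λ x y → P v + (2 * (x * (suc n ∸ d v)) + y * M v)) (m≤n⇒m∸n≡0 (<⇒≤ n<dv)) ([]-no (below? v) (<⇒≱ n<dv)) ⟩
      P v + 0                            ≡⟨ +-identityʳ (P v) ⟩
      P v                                ≤⟨ bound (active? v) ⟩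
      (2 * cost (d v) + M v) + 2 * excess v ∎
    where
      open ≤-Reasoning
      bound : Dec (Active v) → P v ≤ (2 * cost (d v) + M v) + 2 * excess v
      bound (no ¬active) = ≤-trans (inactive-≤ ¬active) (m≤m+n _ _)
      bound (yes (¬twin , 0<P)) with ι , eq ← m≤n⇒∃[o]m+o≡n n<dv = begin
        P v                                    ≤⟨ twinless-bound′ ι (≡.sym eq) ¬twin ⟩
        2 * cost (d v) + 2 * suc (ι * ι)       ≤⟨ +-monoˡ-≤ _ (m≤m+n (2 * cost (d v)) (M v)) ⟩
        (2 * cost (d v) + M v) + 2 * suc (ι * ι)
          ≡⟨ cong (λ z → (2 * cost (d v) + M v) + 2 * z) (≡.trans (≡.sym (*-identityˡ _))
               (cong₂ (λ x y → x * suc (y * y)) (≡.sym ([]-yes (active? v) (¬twin , 0<P)))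
                 (≡.sym (≡.trans (cong (_∸ suc n) (≡.sym eq)) (m+n∸m≡n (suc n) ι))))) ⟩
        (2 * cost (d v) + M v) + 2 * excess v  ∎

  -- Costs of the neighbours of the top active vertex

  module Top (u : Fin V) (¬twin-u : ¬ Twin u) (highest : ∀ v → Active v → d v ≤ d u)
             (κ′ : ℕ) (du≡ : d u ≡ suc n + suc κ′) where

    κ : ℕ
    κ = suc κ′

    κ<n : κ < n
    κ<n = +-cancelˡ-≤ (suc n) _ _ (begin
      suc n + suc κ    ≡⟨ +-suc (suc n) κ ⟩
      suc (suc n + κ)  ≡⟨ cong suc du≡ ⟨
      suc (d u)        ≤⟨ degree<V u ⟩
      V                ≡⟨ 1+n+n≡V ⟨
      suc n + n        ∎)
      where open ≤-Reasoning

    -- If `d w > d u`, then `w` without a twin would be active, against `highest`; with a twin,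
    -- `heavy-twin` gives degree sum V + 1 = 2 n + 2, but both degrees are at least n + 1 and one is
    -- larger.
    heavy-neighbour-lower : ∀ {w} → u ∼ w → V < d u + d w → Heavy u w
    heavy-neighbour-lower {w} uw h with <-cmp (d w) (d u)
    ... | tri< lt _ _ = uw , lt , h
    ... | tri≈ _ eq _ = ⊥-elim (¬twin-u (w , ∼⇒≢ uw ∘ ≡.sym , eq))
    ... | tri> _ _ gt with twin? w
    ...   | no ¬twin = ⊥-elim (<⇒≱ gt (highest w (¬twin , 0<P)))
      where
        h′ : V < d w + d u
        h′ = subst (V <_) (+-comm (d u) (d w)) h
        0<P : 0 < P w
        0<P = begin-strict
          0                       <⟨ s≤s z≤n ⟩
          2 * suc (level w u)     ≡⟨ cong₂ _*_ (c-lower gt) (surplus-heavy (∼-sym uw , gt , h′)) ⟨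
          c w u * surplus w u     ≤⟨ term≤sum (λ x → c w x * surplus w x) u ⟩
          P w                     ∎
          where open ≤-Reasoning
    ...   | yes (b , b≢w , db≡dw) = ⊥-elim (<-irrefl (≡.sym sum≡) (begin-strict
        suc V                            ≡⟨ cong suc 1+n+n≡V ⟨
        suc (suc (n + n))                ≡⟨ cong suc (+-suc n n) ⟨
        suc n + suc n                    ≤⟨ +-mono-≤ (≤-trans (m≤m+n (suc n) κ) (≤-reflexive (≡.sym du≡))) (≤-trans (m≤m+n (suc n) κ) (≤-reflexive (≡.sym du≡))) ⟩
        d u + d u                        <⟨ +-monoˡ-< (d u) gt ⟩
        d w + d u                        ∎))
      where
        open ≤-Reasoning
        sum≡ : d w + d u ≡ suc V
        sum≡ = proj₂ (proj₂ (heavy-twin (b≢w ∘ ≡.sym) (≡.sym db≡dw) (∼-sym uw)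
          (λ { refl → <-irrefl db≡dw gt }) (subst (V <_) (+-comm (d u) (d w)) h)))

    excess-level : ℕ → ℕ
    excess-level t = suc ((κ ∸ t) * (κ ∸ t))

    -- Active vertices have distinct degrees from n + 2 to `d u`, so there is at most one at each
    -- depth below κ.
    total-excess : sum excess ≤ sum {κ} (λ t → 1 * excess-level (toℕ t))
    total-excess = begin
      sum excess ≡⟨ sum-cong-≗ pointwise ⟩
      sum (λ v → [ active? v ] * excess-level (d u ∸ d v))
        ≤⟨ sum-level-bound active? (λ v → d u ∸ d v) (λ _ → 1) excess-level κ level<κ capped ⟩
      sum {κ} (λ t → 1 * excess-level (toℕ t)) ∎
      where
        open ≤-Reasoning
        depth : ∀ {v} ι → d v ≡ suc n + ι → d u ∸ d v ≡ κ ∸ ι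
        depth ι dv≡ = ≡.trans (cong₂ _∸_ du≡ dv≡) ([m+n]∸[m+o]≡n∸o (suc n) κ ι)
        pointwise : ∀ v → excess v ≡ [ active? v ] * excess-level (d u ∸ d v)
        pointwise v = by-activity (active? v)
          where
            by-activity : Dec (Active v) → excess v ≡ [ active? v ] * excess-level (d u ∸ d v)
            by-activity (no ¬active) = ≡.trans (cong (_* suc ((d v ∸ suc n) * (d v ∸ suc n))) ([]-no (active? v) ¬active))
              (≡.sym (cong (_* excess-level (d u ∸ d v)) ([]-no (active? v) ¬active)))
            by-activity (yes active@(¬twin , 0<P)) with ι′ , dv≡ ← twinless-active⇒ ¬twin 0<P =
              cong (λ z → [ active? v ] * suc (z * z)) (≡.trans
                (≡.trans (cong (_∸ suc n) dv≡) (m+n∸m≡n (suc n) (suc ι′)))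
                (≡.sym (≡.trans (cong (κ ∸_) (depth (suc ι′) dv≡)) (m∸[m∸n]≡n
                  (+-cancelˡ-≤ (suc n) _ _ (subst (_≤ suc n + κ) dv≡ (subst (d v ≤_) du≡ (highest v active))))))))
        level<κ : ∀ v → Active v → d u ∸ d v < κ
        level<κ v (¬twin , 0<P) with ι′ , dv≡ ← twinless-active⇒ ¬twin 0<P =
          subst (_< κ) (≡.sym (depth (suc ι′) dv≡)) (s≤s (m∸n≤m κ′ ι′))
        capped : ∀ s → count (λ v → active? v ×-dec (d u ∸ d v ℕ.≟ s)) ≤ 1
        capped s = count≤1 (λ v → active? v ×-dec (d u ∸ d v ℕ.≟ s)) uniq
          where
            uniq : ∀ i j → Active i × d u ∸ d i ≡ s → Active j × d u ∸ d j ≡ s → i ≡ j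
            uniq i j (ai , li) (aj , lj) with i ≟ j
            ... | yes eq = eq
            ... | no i≢j = ⊥-elim (proj₁ aj (i , i≢j , ∸-cancelˡ-≡ (highest i ai) (highest j aj) (≡.trans li (≡.sym lj))))

    -- A neighbour of `u` at level `t` has degree n + 1 - (κ - t). `gap` is what its `negcost` lacks
    -- to κ (κ + 1), a lower bound for `negcost` along edges without surplus.
    negcost-level gap : ℕ → ℕ
    negcost-level t = (κ ∸ t ∸ 1) * (κ ∸ t)
    gap t = κ * suc κ ∸ negcost-level t

    negcost-heavy : ∀ {w} → V < d u + d w → negcost (d w) ≡ negcost-level (level u w)
    negcost-heavy {w} h = cong₂ _*_ below below′
      where
        open ≡.≡-Reasoning
        t = level u w
        poly₁ : ∀ n κ e → suc n + (e + κ) ≡ (suc n + κ) + e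
        poly₁ = solve-∀
        poly₂ : ∀ n t → suc (n + (n + 1)) + t ≡ suc n + (suc n + t)
        poly₂ = solve-∀
        dw+κ : d w + κ ≡ suc n + t
        dw+κ = +-cancelˡ-≡ (suc n) _ _ (begin
          suc n + (d w + κ)        ≡⟨ poly₁ n κ (d w) ⟩
          (suc n + κ) + d w        ≡⟨ cong (_+ d w) du≡ ⟨
          d u + d w                ≡⟨ m+[n∸m]≡n h ⟨
          suc V + t                ≡⟨ poly₂ n t ⟩
          suc n + (suc n + t)      ∎)
        below′ : suc n ∸ d w ≡ κ ∸ t
        below′ = begin
          suc n ∸ d w              ≡⟨ [m+n]∸[m+o]≡n∸o t (suc n) (d w) ⟨
          (t + suc n) ∸ (t + d w)  ≡⟨ cong₂ _∸_ (≡.trans (+-comm t (suc n)) (≡.sym dw+κ)) (+-comm t (d w)) ⟩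
          (d w + κ) ∸ (d w + t)    ≡⟨ [m+n]∸[m+o]≡n∸o (d w) κ t ⟩
          κ ∸ t                    ∎
        below : n ∸ d w ≡ κ ∸ t ∸ 1
        below = begin
          n ∸ d w                  ≡⟨⟩
          suc n ∸ suc (d w)        ≡⟨ cong (suc n ∸_) (+-comm 1 (d w)) ⟩
          suc n ∸ (d w + 1)        ≡⟨ ∸-+-assoc (suc n) (d w) 1 ⟨
          suc n ∸ d w ∸ 1          ≡⟨ cong (_∸ 1) below′ ⟩
          κ ∸ t ∸ 1                ∎

    negcost-light : ∀ {w} → d u + d w ≤ V → κ * suc κ ≤ negcost (d w)
    negcost-light {w} light = *-mono-≤ κ≤ (≤-trans (s≤s κ≤) (≤-reflexive (≡.sym (+-∸-assoc 1 (m+n≤o⇒n≤o κ κ+dw≤n)))))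
      where
        open ≤-Reasoning
        κ+dw≤n : κ + d w ≤ n
        κ+dw≤n = +-cancelˡ-≤ (suc n) _ _ (begin
          suc n + (κ + d w)        ≡⟨ +-assoc (suc n) κ (d w) ⟨
          (suc n + κ) + d w        ≡⟨ cong (_+ d w) du≡ ⟨
          d u + d w                ≤⟨ light ⟩
          V                        ≡⟨ 1+n+n≡V ⟨
          suc n + n                ∎)
        κ≤ : κ ≤ n ∸ d w
        κ≤ = m+n≤o⇒m≤o∸n κ κ+dw≤n

    Q : ℕ
    Q = sum (negcost ∘ d)

    gaps : ℕ
    gaps = sum (λ w → [ heavy? u w ] * gap (level u w))

    neighbour-costs : d u * (κ * suc κ) ≤ Q + gaps
    neighbour-costs = begin
      d u * (κ * suc κ)                            ≡⟨ ∑-adjacent u (κ * suc κ) ⟨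
      sum (λ w → [ u ∼? w ] * (κ * suc κ))         ≤⟨ sum-mono pointwise ⟩
      sum (λ w → negcost (d w) + [ heavy? u w ] * gap (level u w))
        ≡⟨ ∑-distrib-+ (negcost ∘ d) (λ w → [ heavy? u w ] * gap (level u w)) ⟩
      Q + gaps                                     ∎
      where
        open ≤-Reasoning
        pointwise : ∀ w → [ u ∼? w ] * (κ * suc κ) ≤ negcost (d w) + [ heavy? u w ] * gap (level u w)
        pointwise w = go (u ∼? w) (≤-<-connex (d u + d w) V)
          where
            go : Dec (u ∼ w) → (d u + d w ≤ V) ⊎ (V < d u + d w) →
              [ u ∼? w ] * (κ * suc κ) ≤ negcost (d w) + [ heavy? u w ] * gap (level u w)
            go (no ¬uw) _ = ≤-trans (≤-reflexive (cong (_* (κ * suc κ)) ([]-no (u ∼? w) ¬uw))) z≤n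
            go (yes uw) (inj₁ light) = begin
              [ u ∼? w ] * (κ * suc κ)   ≤⟨ *-monoˡ-≤ (κ * suc κ) ([]≤1 (u ∼? w)) ⟩
              1 * (κ * suc κ)            ≡⟨ *-identityˡ _ ⟩
              κ * suc κ                  ≤⟨ negcost-light light ⟩
              negcost (d w)              ≤⟨ m≤m+n _ _ ⟩
              negcost (d w) + [ heavy? u w ] * gap (level u w) ∎
            go (yes uw) (inj₂ h) = begin
              [ u ∼? w ] * (κ * suc κ)   ≤⟨ *-monoˡ-≤ (κ * suc κ) ([]≤1 (u ∼? w)) ⟩
              1 * (κ * suc κ)            ≡⟨ *-identityˡ _ ⟩
              κ * suc κ                  ≤⟨ m≤n+m∸n (κ * suc κ) (negcost-level (level u w)) ⟩
              negcost-level (level u w) + gap (level u w)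
                ≡⟨ cong₂ _+_ (negcost-heavy h) (≡.trans (cong (_* gap (level u w)) ([]-yes (heavy? u w) (heavy-neighbour-lower uw h))) (*-identityˡ _)) ⟨
              negcost (d w) + [ heavy? u w ] * gap (level u w) ∎

    -- `bound` will be `cap` in general, and constantly 1 when `sum M⁻` is zero.
    gaps-≤ : (bound : ℕ → ℕ) → (∀ s → count (λ w → heavy? u w ×-dec (level u w ℕ.≟ s)) ≤ bound s) →
      gaps ≤ sum {κ + κ} (λ t → bound (toℕ t) * gap (toℕ t))
    gaps-≤ bound = sum-level-bound (heavy? u) (level u) bound gap (κ + κ) (λ _ → heavy-level< κ du≡)

    S X : ℕ
    S = sum {κ} (λ t → 1 * gap (toℕ t))
    X = sum {κ} (λ t → 1 * excess-level (toℕ t))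

    simple-gaps : sum {κ + κ} (λ t → 1 * gap (toℕ t)) ≤ S + κ * (κ * suc κ)
    simple-gaps = begin
      sum {κ + κ} (λ t → 1 * gap (toℕ t))              ≡⟨ sum-split κ κ (λ t → 1 * gap t) ⟩
      S + sum {κ} (λ t → 1 * gap (κ + toℕ t))          ≤⟨ +-monoʳ-≤ S (sum-mono {κ} λ t → ≤-trans (≤-reflexive (*-identityˡ (gap (κ + toℕ t)))) (m∸n≤m (κ * suc κ) (negcost-level (κ + toℕ t)))) ⟩
      S + sum {κ} (λ _ → κ * suc κ)                    ≡⟨ cong (S +_) (sum-const κ (κ * suc κ)) ⟩
      S + κ * (κ * suc κ)                              ∎
      where open ≤-Reasoning

    -- A second neighbour at level 0 adds `gap 0`, which is κ (κ + 1) - (κ - 1) κ = 2 κ.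
    capped-gaps : sum {κ + κ} (λ t → cap (toℕ t) * gap (toℕ t)) ≤ 2 * κ + (S + κ * (κ * suc κ))
    capped-gaps = begin
      2 * gap 0 + R               ≡⟨ poly (gap 0) R ⟩
      gap 0 + (1 * gap 0 + R)     ≤⟨ +-mono-≤ gap0 simple-gaps ⟩
      2 * κ + (S + κ * (κ * suc κ)) ∎
      where
        open ≤-Reasoning
        R = sum {κ′ + κ} (λ t → 1 * gap (suc (toℕ t)))
        poly : ∀ g r → 2 * g + r ≡ g + (1 * g + r)
        poly = solve-∀
        gap0 : gap 0 ≤ 2 * κ
        gap0 = m≤n+o⇒m∸n≤o (κ * suc κ) (κ′ * κ) (≤-reflexive (poly₂ κ′))
          where
            poly₂ : ∀ k → suc k * suc (suc k) ≡ k * suc k + 2 * suc k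
            poly₂ = solve-∀

    -- With i = κ - t, the terms at `t` add up to κ (κ + 1) + i + 1, because i² + 1 - (i - 1) i = i
    -- + 1.
    X+S≤ : X + S ≤ κ * (κ * suc κ + suc κ)
    X+S≤ = begin
      X + S
        ≡⟨ ∑-distrib-+ {κ} (λ t → 1 * excess-level (toℕ t)) (λ t → 1 * gap (toℕ t)) ⟨
      sum {κ} (λ t → 1 * excess-level (toℕ t) + 1 * gap (toℕ t))
        ≤⟨ sum-mono {κ} (λ t → subst (_≤ κ * suc κ + suc κ) (≡.sym (cong₂ _+_ (*-identityˡ (excess-level (toℕ t))) (*-identityˡ (gap (toℕ t))))) (pointwise (κ ∸ toℕ t) (m∸n≤m κ (toℕ t)))) ⟩
      sum {κ} (λ _ → κ * suc κ + suc κ)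
        ≡⟨ sum-const κ (κ * suc κ + suc κ) ⟩
      κ * (κ * suc κ + suc κ) ∎
      where
        open ≤-Reasoning
        pointwise : ∀ i → i ≤ κ → suc (i * i) + (κ * suc κ ∸ (i ∸ 1) * i) ≤ κ * suc κ + suc κ
        pointwise zero    _ = ≤-trans (≤-reflexive (+-comm 1 (κ * suc κ))) (+-monoʳ-≤ (κ * suc κ) (s≤s z≤n))
        pointwise (suc j) i≤κ = begin
          suc (suc j * suc j) + (κ * suc κ ∸ j * suc j)           ≡⟨ poly j (κ * suc κ ∸ j * suc j) ⟩
          suc (suc j) + (j * suc j + (κ * suc κ ∸ j * suc j))     ≡⟨ cong (suc (suc j) +_) (m+[n∸m]≡n (*-mono-≤ (≤-trans (n≤1+n j) i≤κ) (≤-trans i≤κ (n≤1+n κ)))) ⟩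
          suc (suc j) + κ * suc κ                                 ≤⟨ +-monoˡ-≤ (κ * suc κ) (s≤s i≤κ) ⟩
          suc κ + κ * suc κ                                       ≡⟨ +-comm (suc κ) (κ * suc κ) ⟩
          κ * suc κ + suc κ                                       ∎
          where
            poly : ∀ j r → suc (suc j * suc j) + r ≡ suc (suc j) + (j * suc j + r)
            poly = solve-∀

    -- As κ < n, `u` has at least 2 κ + 2 neighbours, each worth κ (κ + 1). The gaps at levels from
    -- κ on take κ of these shares, `X+S≤` takes κ + 1, `S` cancels, and one share is left.
    excess≤Q : ∀ e → gaps ≤ e + (S + κ * (κ * suc κ)) → sum excess + κ * suc κ ≤ Q + e
    excess≤Q e gaps≤ = ≤-from 0 _ _
      (+-mono-≤ total-excess (+-mono-≤ X+S≤ (+-mono-≤ gaps≤ (+-mono-≤ neighbour-costs degree-large))))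
      (poly (sum excess) X S gaps Q e κ (d u * (κ * suc κ)))
      where
        degree-large : (suc κ + suc κ) * (κ * suc κ) ≤ d u * (κ * suc κ)
        degree-large = *-monoˡ-≤ (κ * suc κ) (begin
          suc κ + suc κ  ≤⟨ +-monoˡ-≤ (suc κ) κ<n ⟩
          n + suc κ      ≡⟨ +-suc n κ ⟩
          suc n + κ      ≡⟨ du≡ ⟨
          d u            ∎)
          where open ≤-Reasoning
        poly : ∀ x X S g Q e κ D →
          x + κ * suc κ + (X + (κ * (κ * suc κ + suc κ) + (e + (S + κ * (κ * suc κ)) + (Q + g + D)))) + 0
          ≡ Q + e + (x + (X + S + (g + (D + (suc κ + suc κ) * (κ * suc κ)))))
        poly = solve-∀

    -- Two neighbours of u at the same level would be joined by an edge of deficit.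
    no-M⁻⇒simple : sum M⁻ ≡ 0 → ∀ s → count (λ w → heavy? u w ×-dec (level u w ℕ.≟ s)) ≤ 1
    no-M⁻⇒simple M⁻≡0 s = count≤1 (λ w → heavy? u w ×-dec (level u w ℕ.≟ s)) uniq
      where
        uniq : ∀ i j → Heavy u i × level u i ≡ s → Heavy u j × level u j ≡ s → i ≡ j
        uniq i j ((ui , _ , hi) , li) ((uj , _ , hj) , lj) with i ≟ j
        ... | yes eq = eq
        ... | no i≢j = ⊥-elim (<-irrefl (≡.sym (sum≡0⇒≡0 M⁻ M⁻≡0 i)) 0<M⁻)
          where
            di≡dj : d i ≡ d j
            di≡dj = level-injective hi hj (≡.trans li (≡.sym lj))
            ij : i ∼ j × d u + d i ≡ suc V
            ij = twin-neighbours ui uj i≢j di≡dj hi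
            di≤n : d i ≤ n
            di≤n = +-cancelˡ-≤ (suc (suc n)) _ _ (begin
              suc (suc n) + d i        ≤⟨ +-monoˡ-≤ (d i) (s≤s (≤-trans (≤-reflexive (+-comm 1 n)) (+-monoʳ-≤ n (s≤s z≤n)))) ⟩
              suc (n + suc κ′) + d i   ≡⟨ cong (_+ d i) du≡ ⟨
              d u + d i                ≡⟨ proj₂ ij ⟩
              suc V                    ≡⟨ cong suc 1+n+n≡V ⟨
              suc (suc n) + n          ∎)
              where open ≤-Reasoning
            light : d i + d j < V
            light = begin-strict
              d i + d j    ≤⟨ +-mono-≤ di≤n (subst (_≤ n) di≡dj di≤n) ⟩
              n + n        <⟨ n<1+n (n + n) ⟩
              suc (n + n)  ≡⟨ 1+n+n≡V ⟩
              V            ∎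
              where open ≤-Reasoning
            0<M⁻ : 0 < M⁻ i
            0<M⁻ = begin-strict
              0                               <⟨ m<n⇒0<n∸m light ⟩
              V ∸ (d i + d j)                 ≡⟨ ≡.trans (*-identityˡ _) (*-identityˡ _) ⟨
              1 * (1 * (V ∸ (d i + d j)))     ≡⟨ cong₂ (λ x y → x * (y * (V ∸ (d i + d j)))) (c-tie (≡.sym di≡dj)) ([]-yes (i ∼? j) (proj₁ ij)) ⟨
              c i j * deficit i j             ≤⟨ term≤sum (λ w → c i w * deficit i w) j ⟩
              M i                             ≡⟨ *-identityˡ (M i) ⟨
              1 * M i                         ≡⟨ cong (_* M i) ([]-yes (below? i) di≤n) ⟨
              M⁻ i                            ∎
              where open ≤-Reasoning

    -- If `sum M⁻` is zero, the spare share κ (κ + 1) gives strictness. Otherwise twice that share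
    -- covers the 4 κ from a doubled level 0, and `sum M⁻` gives strictness.
    excess-compensated : 2 * sum excess < 2 * Q + sum M⁻
    excess-compensated with sum M⁻ in eq
    ... | zero  = ≤-trans (*-monoʳ-< 2 (<-≤-trans (m<m+n (sum excess) (s≤s z≤n))
                    (≤-trans (excess≤Q 0 (≤-trans (gaps-≤ (λ _ → 1) (no-M⁻⇒simple eq)) simple-gaps)) (≤-reflexive (+-identityʳ Q)))))
                    (m≤m+n (2 * Q) 0)
    ... | suc m = ≤-from (2 * (κ′ * κ) + m) _ _ (*-monoʳ-≤ 2 (excess≤Q (2 * κ) (≤-trans (gaps-≤ cap (heavy-cap u)) capped-gaps)))
                    (poly (sum excess) Q κ′ m)
      where
        poly : ∀ x Q k m → suc (2 * x) + 2 * (Q + 2 * suc k) + (2 * (k * suc k) + m) ≡ 2 * Q + suc m + 2 * (x + suc k * suc (suc k))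
        poly = solve-∀

  -- With an active vertex, `vertex-bound` is summed and `excess-compensated` absorbs the excesses.
  -- Without one, any vertex with positive `P v` makes the summed inequality strict.
  total-bound : sum P ≡ 0 ⊎ sum P < 2 * sum (cost ∘ d) + sum M
  total-bound with any? active?
  ... | yes some with u , (¬twin , 0<P) , highest ← maximal active? d some
    with κ′ , du≡ ← twinless-active⇒ ¬twin 0<P = inj₂ (+-cancelʳ-< (2 * Q + sum M⁻) _ _ (begin-strict
      sum P + (2 * Q + sum M⁻)
        ≡⟨ ≡.trans (∑-distrib-+ P (λ v → 2 * negcost (d v) + M⁻ v)) (cong (sum P +_) (∑-2*+ (negcost ∘ d) M⁻)) ⟨
      sum (λ v → P v + (2 * negcost (d v) + M⁻ v))
        ≤⟨ sum-mono vertex-bound ⟩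
      sum (λ v → (2 * cost (d v) + M v) + 2 * excess v)
        ≡⟨ ≡.trans (∑-distrib-+ (λ v → 2 * cost (d v) + M v) (λ v → 2 * excess v))
                   (cong₂ _+_ (∑-2*+ (cost ∘ d) M) (≡.sym (*-distribˡ-sum 2 excess))) ⟩
      (2 * sum (cost ∘ d) + sum M) + 2 * sum excess
        <⟨ +-monoʳ-< (2 * sum (cost ∘ d) + sum M) excess-compensated ⟩
      (2 * sum (cost ∘ d) + sum M) + (2 * Q + sum M⁻) ∎))
    where
      open ≤-Reasoning
      open Top u ¬twin highest κ′ du≡
      ∑-2*+ : ∀ (f g : Fin V → ℕ) → sum (λ v → 2 * f v + g v) ≡ 2 * sum f + sum g
      ∑-2*+ f g = ≡.trans (∑-distrib-+ (λ v → 2 * f v) g) (cong (_+ sum g) (≡.sym (*-distribˡ-sum 2 f)))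
  total-bound | no none with any? (λ v → 0 <? P v)
  ... | no all0 = inj₁ (sum-zero λ v → n≤0⇒n≡0 (≮⇒≥ λ 0<P → all0 (v , 0<P)))
  ... | yes (v , 0<P) = inj₂ (begin-strict
      sum P                               <⟨ sum-mono-< (λ w → inactive-≤ (λ a → none (w , a))) v P-v-strict ⟩
      sum (λ v → 2 * cost (d v) + M v)    ≡⟨ ≡.trans (∑-distrib-+ (λ v → 2 * cost (d v)) M) (cong (_+ sum M) (≡.sym (*-distribˡ-sum 2 (cost ∘ d)))) ⟩
      2 * sum (cost ∘ d) + sum M          ∎)
    where
      open ≤-Reasoning
      P-v-strict : P v < 2 * cost (d v) + M v
      P-v-strict with inactive-bound (λ a → none (v , a))
      ... | inj₁ eq = ⊥-elim (<-irrefl (≡.sym eq) 0<P)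
      ... | inj₂ lt = lt

-- The equality case

-- `sorted` has the form of the test by which `K` assigns sides, so `to` is an isomorphism once
-- adjacency is the xor of `s`.
record Arrangement {m} (s : Fin m → Bool) (k : ℕ) : Set where
  field
    to         : Fin m → Fin m
    injective  : ∀ {i j} → to i ≡ to j → i ≡ j
    surjective : ∀ j → ∃ λ i → to i ≡ j
    sorted     : ∀ i → s i ≡ (toℕ (to i) <ᵇ k)

-- An element with value `true` goes to the front and shifts the others; one with value `false` goes
-- to the last position and leaves them in place.
arrange : ∀ {m} (s : Fin m → Bool) → Arrangement s (count (λ i → T? (s i)))
arrange {zero} s = record { to = λ i → i ; injective = λ eq → eq ; surjective = λ () ; sorted = λ () }
arrange {suc m} s with s zero in s0 | arrange (s ∘ suc)
... | true | rest = record { to = to ; injective = inj ; surjective = surj ; sorted = srt }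
  where
    module R = Arrangement rest
    to : Fin (suc m) → Fin (suc m)
    to zero    = zero
    to (suc i) = suc (R.to i)
    inj : ∀ {i j} → to i ≡ to j → i ≡ j
    inj {zero}  {zero}  _  = refl
    inj {suc i} {suc j} eq = cong suc (R.injective (suc-injective eq))
    surj : ∀ j → ∃ λ i → to i ≡ j
    surj zero    = zero , refl
    surj (suc j) with i , eq ← R.surjective j = suc i , cong suc eq
    srt : ∀ i → s i ≡ (toℕ (to i) <ᵇ suc (count (λ i → T? (s (suc i)))))
    srt zero    = s0
    srt (suc i) = R.sorted i
... | false | rest = record { to = to ; injective = inj ; surjective = surj ; sorted = srt }
  where
    module R = Arrangement rest
    to : Fin (suc m) → Fin (suc m)
    to zero    = fromℕ m
    to (suc i) = inject₁ (R.to i)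
    inj : ∀ {i j} → to i ≡ to j → i ≡ j
    inj {zero}  {zero}  _  = refl
    inj {zero}  {suc j} eq = ⊥-elim (fromℕ≢inject₁ eq)
    inj {suc i} {zero}  eq = ⊥-elim (fromℕ≢inject₁ (≡.sym eq))
    inj {suc i} {suc j} eq = cong suc (R.injective (inject₁-injective eq))
    surj : ∀ j → ∃ λ i → to i ≡ j
    surj j with view j
    ... | ‵fromℕ = zero , refl
    ... | ‵inject₁ j′ with i , eq ← R.surjective j′ = suc i , cong inject₁ eq
    k≤m : count (λ i → T? (s (suc i))) ≤ m
    k≤m = ≤-trans (sum-mono λ i → []≤1 (T? (s (suc i)))) (≤-reflexive (≡.trans (sum-const m 1) (*-identityʳ m)))
    ≮ᵇ : ∀ {i k} → k ≤ i → (i <ᵇ k) ≡ false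
    ≮ᵇ {i} {k} k≤i with i <ᵇ k in eq
    ... | false = refl
    ... | true  = ⊥-elim (<⇒≱ (<ᵇ⇒< i k (subst T (≡.sym eq) _)) k≤i)
    srt : ∀ i → s i ≡ (toℕ (to i) <ᵇ count (λ i → T? (s (suc i))))
    srt zero    = ≡.trans s0 (≡.sym (≮ᵇ (≤-trans k≤m (≤-reflexive (≡.sym (toℕ-fromℕ m))))))
    srt (suc i) = ≡.trans (R.sorted i) (cong (_<ᵇ count (λ i → T? (s (suc i)))) (≡.sym (toℕ-inject₁ (R.to i))))

arrangement⇒≅ : ∀ m k (G : Graph (m + k)) {s} → Arrangement s m →
  (∀ v w → adj G v w ≡ (s v xor s w)) → G ≅ K m k
arrangement⇒≅ m k G A adj≡ =
  mk⤖ (Arrangement.injective A , strictlySurjective⇒surjective (Arrangement.surjective A)) ,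
  λ v w → ≡.trans (adj≡ v w) (cong₂ _xor_ (Arrangement.sorted A v) (Arrangement.sorted A w))

module Equality (n : ℕ) (2≤n : 2 ≤ n) (G : Graph (n + (n + 1))) (noP3 : ¬ HasEqualDegreeP3 G)
                (many-edges : 2 * (n * suc n) ≤ sum (Adjacency.d G)) where
  open Adjacency G
  open Energy n G
  open Extremal n 2≤n G noP3

  cost+M≤P : 2 * sum (cost ∘ d) + sum M ≤ sum P
  cost+M≤P = +-cancelʳ-≤ (V * sum d) _ _ (≤-trans (≤-reflexive balance) (+-monoʳ-≤ (sum P) (*-monoʳ-≤ V many-edges)))

  P≡0 : sum P ≡ 0
  P≡0 with total-bound
  ... | inj₁ eq = eq
  ... | inj₂ lt = ⊥-elim (<⇒≱ lt cost+M≤P)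

  cost+M≡0 : 2 * sum (cost ∘ d) + sum M ≡ 0
  cost+M≡0 = n≤0⇒n≡0 (≤-trans cost+M≤P (≤-reflexive P≡0))

  cost≡0 : ∀ v → cost (d v) ≡ 0
  cost≡0 = sum≡0⇒≡0 (cost ∘ d) (m+n≡0⇒m≡0 _ (m+n≡0⇒m≡0 _ cost+M≡0))

  M≡0 : sum M ≡ 0
  M≡0 = m+n≡0⇒n≡0 (2 * sum (cost ∘ d)) cost+M≡0

  -- What remains of `balance` is an equation with the common factor `V`, written as `suc (n + n)`
  -- to be visibly nonzero.
  ∑d≡ : sum d ≡ 2 * (n * suc n)
  ∑d≡ = *-cancelˡ-≡ (sum d) _ (suc (n + n)) (≡.trans (cong (_* sum d) 1+n+n≡V)
    (≡.trans (≡.trans (cong (_+ V * sum d) (≡.sym cost+M≡0)) (≡.trans balance (cong (_+ V * (2 * (n * suc n))) P≡0)))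
             (cong (_* (2 * (n * suc n))) (≡.sym 1+n+n≡V))))
    where open VertexBounds n G noP3 using (1+n+n≡V)

  ∑∑≡0⇒≡0 : ∀ {φ} → ∑∑ φ ≡ 0 → ∀ v w → φ v w ≡ 0
  ∑∑≡0⇒≡0 {φ} eq v = sum≡0⇒≡0 (φ v) (sum≡0⇒≡0 (λ v → sum (φ v)) eq v)

  -- `c v w` may be zero, so `c-weighted` removes it before the single surpluses and deficits are
  -- seen to vanish.
  edge-degrees : ∀ {v w} → v ∼ w → d v + d w ≡ V
  edge-degrees {v} {w} vw = ≤-antisym
    (m∸n≡0⇒m≤n (strip (∑∑≡0⇒≡0 (≡.trans (≡.sym (c-weighted surplus surplus-sym)) P≡0) v w)))
    (m∸n≡0⇒m≤n (strip (∑∑≡0⇒≡0 (≡.trans (≡.sym (c-weighted deficit deficit-sym)) M≡0) v w)))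
    where
      strip : ∀ {x} → [ v ∼? w ] * x ≡ 0 → x ≡ 0
      strip {x} eq = ≡.trans (≡.sym (*-identityˡ x)) (≡.trans (cong (_* x) (≡.sym ([]-yes (v ∼? w) vw))) eq)

  high? : ∀ v → Dec (d v ≡ suc n)
  high? v = d v ℕ.≟ suc n

  low⇒≡n : ∀ {v} → d v ≢ suc n → d v ≡ n
  low⇒≡n {v} low with ≤-<-connex (d v) n
  ... | inj₁ dv≤n with m*n≡0⇒m≡0∨n≡0 (n ∸ d v) (≡.trans (≡.sym (cost-below dv≤n)) (cost≡0 v))
  ...   | inj₁ eq = ≤-antisym dv≤n (m∸n≡0⇒m≤n eq)
  ...   | inj₂ eq = ⊥-elim (<⇒≱ (s≤s dv≤n) (m∸n≡0⇒m≤n eq))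
  low⇒≡n {v} low | inj₂ n<dv with m≤n⇒∃[o]m+o≡n n<dv
  ... | zero , eq = ⊥-elim (low (≡.trans (≡.sym eq) (+-identityʳ (suc n))))
  ... | suc i , eq with () ← ≡.trans (≡.sym (cost-above (suc i))) (≡.trans (cong cost eq) (cost≡0 v))

  -- All degrees are `n` or `n + 1`, so `sum d` is V n plus this count, while 2 n (n + 1) = V n + n.
  count-high : count high? ≡ n
  count-high = +-cancelˡ-≡ (V * n) _ _ (begin
    V * n + count high?                   ≡⟨ cong (_+ count high?) (sum-const V n) ⟨
    sum {V} (λ _ → n) + count high?       ≡⟨ ∑-distrib-+ (λ _ → n) (λ v → [ high? v ]) ⟨
    sum (λ v → n + [ high? v ])           ≡⟨ sum-cong-≗ (λ v → d≡ v (high? v)) ⟨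
    sum d                                 ≡⟨ ∑d≡ ⟩
    2 * (n * suc n)                       ≡⟨ poly n ⟩
    V * n + n                             ∎)
    where
      open ≡.≡-Reasoning
      poly : ∀ n → 2 * (n * suc n) ≡ (n + (n + 1)) * n + n
      poly = solve-∀
      d≡ : ∀ v → Dec (d v ≡ suc n) → d v ≡ n + [ high? v ]
      d≡ v (yes high) = ≡.trans high (≡.trans (+-comm 1 n) (cong (n +_) (≡.sym ([]-yes (high? v) high))))
      d≡ v (no low)   = ≡.trans (low⇒≡n low) (≡.trans (≡.sym (+-identityʳ n)) (cong (n +_) (≡.sym ([]-no (high? v) low))))

  high-independent : ∀ {v w} → d v ≡ suc n → d w ≡ suc n → ¬ v ∼ w
  high-independent hv hw vw = m+1+n≢m V (≡.trans (poly n) (≡.trans (≡.sym (cong₂ _+_ hv hw)) (edge-degrees vw)))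
    where
      poly : ∀ n → n + (n + 1) + 1 ≡ suc n + suc n
      poly = solve-∀

  low-independent : ∀ {v w} → d v ≢ suc n → d w ≢ suc n → ¬ v ∼ w
  low-independent lv lw vw = m+1+n≢m (n + n) (≡.trans (+-assoc n n 1) (≡.trans (≡.sym (edge-degrees vw)) (cong₂ _+_ (low⇒≡n lv) (low⇒≡n lw))))

  -- The n + 1 neighbours of `v` and the n high vertices are disjoint and number V together, so
  -- every low vertex is a neighbour.
  high-low-adjacent : ∀ {v w} → d v ≡ suc n → d w ≢ suc n → v ∼ w
  high-low-adjacent {v} {w} hv lw with v ∼? w
  ... | yes vw = vw
  ... | no ¬vw = ⊥-elim (<-irrefl total (sum-mono-< pointwise w strict-at-w))
    where
      pointwise : ∀ x → [ v ∼? x ] + [ high? x ] ≤ 1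
      pointwise x = go (high? x)
        where
          go : Dec (d x ≡ suc n) → [ v ∼? x ] + [ high? x ] ≤ 1
          go (yes hx) = ≤-trans (≤-reflexive (cong (_+ [ high? x ]) ([]-no (v ∼? x) (high-independent hv hx)))) ([]≤1 (high? x))
          go (no lx)  = ≤-trans (≤-reflexive (≡.trans (cong ([ v ∼? x ] +_) ([]-no (high? x) lx)) (+-identityʳ _))) ([]≤1 (v ∼? x))
      strict-at-w : [ v ∼? w ] + [ high? w ] < 1
      strict-at-w = s≤s (≤-reflexive (cong₂ _+_ ([]-no (v ∼? w) ¬vw) ([]-no (high? w) lw)))
      poly : ∀ n → suc n + n ≡ (n + (n + 1)) * 1
      poly = solve-∀
      total : sum (λ x → [ v ∼? x ] + [ high? x ]) ≡ sum {V} (λ _ → 1)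
      total = ≡.trans (∑-distrib-+ (λ x → [ v ∼? x ]) (λ x → [ high? x ]))
        (≡.trans (cong₂ _+_ (≡.trans (≡.sym (degree≡count v)) hv) count-high) (≡.trans (poly n) (≡.sym (sum-const V 1))))

  side : Fin V → Bool
  side v = does (high? v)

  adj≡xor : ∀ v w → adj G v w ≡ (side v xor side w)
  adj≡xor v w = go (high? v) (high? w)
    where
      adjacent : v ∼ w → adj G v w ≡ true
      adjacent = Equivalence.to T-≡
      nonadjacent : ¬ v ∼ w → adj G v w ≡ false
      nonadjacent ¬vw = ¬-not (¬vw ∘ Equivalence.from T-≡)
      go : Dec (d v ≡ suc n) → Dec (d w ≡ suc n) → adj G v w ≡ (side v xor side w)
      go (yes hv) (yes hw) = ≡.trans (nonadjacent (high-independent hv hw)) (≡.sym (cong₂ _xor_ (dec-true (high? v) hv) (dec-true (high? w) hw)))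
      go (yes hv) (no lw)  = ≡.trans (adjacent (high-low-adjacent hv lw)) (≡.sym (cong₂ _xor_ (dec-true (high? v) hv) (dec-false (high? w) lw)))
      go (no lv)  (yes hw) = ≡.trans (adjacent (∼-sym (high-low-adjacent hw lv))) (≡.sym (cong₂ _xor_ (dec-false (high? v) lv) (dec-true (high? w) hw)))
      go (no lv)  (no lw)  = ≡.trans (nonadjacent (low-independent lv lw)) (≡.sym (cong₂ _xor_ (dec-false (high? v) lv) (dec-false (high? w) lw)))

  isomorphism : G ≅ K n (n + 1)
  isomorphism = arrangement⇒≅ n (n + 1) G (subst (Arrangement side) count-side (arrange side)) adj≡xor
    where
      count-side : count (λ v → T? (side v)) ≡ n
      count-side = count-high

theorem1p2 : (n : ℕ) → 2 ≤ n → (G : Graph (n + (n + 1))) →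
    n * n + n ≤ edgeCount G → ¬ HasEqualDegreeP3 G → G ≅ K n (n + 1)
theorem1p2 n 2≤n G edges noP3 = Equality.isomorphism n 2≤n G noP3 (begin
  2 * (n * suc n)                        ≡⟨ poly n ⟩
  (n * n + n) + (n * n + n)              ≤⟨ +-mono-≤ edges edges ⟩
  edgeCount G + edgeCount G              ≤⟨ 2*edgeCount≤ G ⟩
  sum (degree G)                         ≡⟨ sum-cong-≗ (Adjacency.d≡degree G) ⟨
  sum (Adjacency.d G)                    ∎)
  where
    open ≤-Reasoning
    poly : ∀ n → 2 * (n * suc n) ≡ (n * n + n) + (n * n + n)
    poly = solve-∀
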